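{- Let $E=\{0,1,\dots,n\}$ and let $M$ be a loopless matroid of rank $r+1$ on $E$. Let $c_1,\dots,c_n$ be nonnegative integers with $c_1+\dots+c_n=r-2$, and let $1\le i,j\le n$. Then \[\deg_M(\gamma_1^{c_1}\cdots\gamma_n^{c_n}\gamma_i^2)\,\deg_M(\gamma_1^{c_1}\cdots\gamma_n^{c_n}\gamma_j^2)\le \deg_M(\gamma_1^{c_1}\cdots\gamma_n^{c_n}\gamma_i\gamma_j)^2.\]
   Context: The Chow ring $A^*(M)$ (real coefficients) is $\mathbb{R}[x_F : F \text{ a nonempty proper flat of } M]$ modulo the ideal generated by all $x_{F_1}x_{F_2}$ with $F_1,F_2$ incomparable and all $\sum_{F\ni i}x_F-\sum_{F\ni j}x_F$ for $i,j\in E$. It is graded, and $\deg_M:A^r(M)\to\mathbb{R}$ is the linear map with $\deg_M(x_{F_1}\cdots x_{F_r})=1$ for every complete flag of flats $\varnothing\subsetneq F_1\subsetneq\cdots\subsetneq F_r\subsetneq E$. For $S\subseteq E$, $x_S$ means the generator if $S$ is a nonempty proper flat and $0$ otherwise. For $1\le k\le n$ the hypersimplex class is $\gamma_k=\sum_{S}\left(\min(|S|,k)-\frac{k}{n+1}|S|\right)x_S\in A^1(M)$, the sum over nonempty proper subsets $S\subsetneq E$. -}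

module Defs where

open import Data.Nat as ℕ using (ℕ; zero; suc; _⊓_; _≤_; _<_)
open import Data.Integer using (+_)
open import Data.Rational using (ℚ; _/_; 0ℚ; 1ℚ; _-_)
import Data.Rational as Q
open import Data.Fin using (Fin; toℕ)
open import Data.Fin.Properties using (all?)
open import Data.Fin.Subset using (Subset; inside; outside; _∈_; _∉_; _⊆_; _⊂_; _∪_; _∩_; ∣_∣; ⁅_⁆; ⊥; ⊤)
open import Data.Fin.Subset.Properties using (_∈?_)
open import Data.Vec using (Vec; []; _∷_)
open import Data.Vec.Properties using (≡-dec)
import Data.Bool.Properties as BoolP
open import Data.List using (List; []; _∷_; _++_; map; foldr; filter; concatMap; replicate; length; allFin)
open import Data.List.Relation.Unary.All using (All)
open import Data.List.Relation.Unary.Linked using (Linked)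
open import Data.List.Relation.Binary.Permutation.Propositional using (_↭_)
open import Data.Product using (_×_; Σ)
open import Relation.Binary.PropositionalEquality using (_≡_; _≢_)
open import Relation.Nullary using (¬_; Dec)
open import Relation.Nullary.Decidable using (_→-dec_; _×-dec_; ¬?)

record Matroid (m : ℕ) : Set where
  field
    rk        : Subset m → ℕ
    rk-bound  : ∀ X → rk X ≤ ∣ X ∣
    rk-mono   : ∀ X Y → X ⊆ Y → rk X ≤ rk Y
    rk-submod : ∀ X Y → rk (X ∪ Y) ℕ.+ rk (X ∩ Y) ≤ rk X ℕ.+ rk Y
open Matroid public

Loopless : ∀ {m} → Matroid m → Set
Loopless M = ∀ e → rk M ⁅ e ⁆ ≡ 1

IsFlat : ∀ {m} → Matroid m → Subset m → Set
IsFlat M X = ∀ e → e ∉ X → rk M X < rk M (X ∪ ⁅ e ⁆)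

isFlat? : ∀ {m} (M : Matroid m) (X : Subset m) → Dec (IsFlat M X)
isFlat? M X = all? (λ e → ¬? (e ∈? X) →-dec (rk M X ℕ.<? rk M (X ∪ ⁅ e ⁆)))

-- nonempty proper flat (the variables x_F of the Chow ring)
IsPFlat : ∀ {m} → Matroid m → Subset m → Set
IsPFlat M X = (X ≢ ⊥ × X ≢ ⊤) × IsFlat M X

isPFlat? : ∀ {m} (M : Matroid m) (X : Subset m) → Dec (IsPFlat M X)
isPFlat? M X =
  (¬? (≡-dec BoolP._≟_ X ⊥) ×-dec ¬? (≡-dec BoolP._≟_ X ⊤)) ×-dec isFlat? M X

allSubsets : (m : ℕ) → List (Subset m)
allSubsets zero = [] ∷ []
allSubsets (suc m) = map (inside ∷_) (allSubsets m) ++ map (outside ∷_) (allSubsets m)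

flats : ∀ {m} → Matroid m → List (Subset m)
flats M = filter (isPFlat? M) (allSubsets _)

Σℚ : ∀ {A : Set} → List A → (A → ℚ) → ℚ
Σℚ xs f = foldr Q._+_ 0ℚ (map f xs)

-- A (degree-r) "degree functional" for M: a function on degree-r monomials
-- in the variables x_F (monomials = lists of nonempty proper flats, taken up to
-- permutation), i.e. a linear functional on the degree-r part of the polynomial
-- ring, which vanishes on the degree-r part of the defining ideal of A*(M)
-- (spanned by monomials times generators) and takes value 1 on every complete
-- flag F₁ ⊊ ⋯ ⊊ F_r.  Such a functional is exactly deg_M : A^r(M) → ℝ
-- (restricted to rational values, which suffices since all classes here are
-- rational).
record IsDeg {m : ℕ} (M : Matroid m) (r : ℕ) (L : List (Subset m) → ℚ) : Set where
  field
    symm   : ∀ a b → a ↭ b → L a ≡ L b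
    incomp : ∀ F G (mon : List (Subset m)) →
             IsPFlat M F → IsPFlat M G → All (IsPFlat M) mon →
             ¬ (F ⊆ G) → ¬ (G ⊆ F) →
             length (F ∷ G ∷ mon) ≡ r → L (F ∷ G ∷ mon) ≡ 0ℚ
    linrel : ∀ (i j : Fin m) (mon : List (Subset m)) →
             All (IsPFlat M) mon → suc (length mon) ≡ r →
             Σℚ (filter (i ∈?_) (flats M)) (λ F → L (F ∷ mon))
               ≡ Σℚ (filter (j ∈?_) (flats M)) (λ F → L (F ∷ mon))
    flag   : ∀ (fs : List (Subset m)) → All (IsPFlat M) fs →
             Linked _⊂_ fs → length fs ≡ r → L fs ≡ 1ℚ

-- A linear form in the x_F, given by its coefficient function on subsets
-- (only coefficients of nonempty proper flats matter: x_S = 0 otherwise).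
LinForm : ℕ → Set
LinForm m = Subset m → ℚ

-- L applied to the product of the linear forms ℓ₁ ⋯ ℓ_k (expanded
-- multilinearly over the nonempty proper flats).
evalProd : ∀ {m} → Matroid m → List (LinForm m) → (List (Subset m) → ℚ) → ℚ
evalProd M [] L = L []
evalProd M (ℓ ∷ ls) L = Σℚ (flats M) (λ F → ℓ F Q.* evalProd M ls (λ mon → L (F ∷ mon)))

-- hypersimplex class γ_k on E = {0,…,n} = Fin (suc n):
-- coefficient of x_S is min(|S|,k) − k|S|/(n+1)
γ : (n k : ℕ) → LinForm (suc n)
γ n k S = ((+ (∣ S ∣ ⊓ k)) / 1) - ((+ (k ℕ.* ∣ S ∣)) / suc n)

-- the list γ_1^{c_1} ⋯ γ_n^{c_n}  (index t : Fin n stands for t+1)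
γpow : (n : ℕ) → (Fin n → ℕ) → List (LinForm (suc n))
γpow n c = concatMap (λ t → replicate (c t) (γ n (suc (toℕ t)))) (allFin n)

sumFin : (n : ℕ) → (Fin n → ℕ) → ℕ
sumFin n c = foldr ℕ._+_ 0 (map c (allFin n))

{-# OPTIONS --safe #-}

-- Let deg(x_C · v₁ ⋯ v_l) be the degree of a product of the variables of a chain C
-- of flats and of l linear forms.  Call a form ample if, for every chain C, it can be
-- changed by a linear relation so as to vanish on C and be positive on every flat
-- that extends C; functions of |S| that are strictly concave and vanish at ∅ and E are
-- ample, by piecewise linear interpolation along C.  By induction on the number of
-- ample factors v₁, …, v_l, the form (x , y) ↦ deg(x_C · x y v₁ ⋯ v_l) satisfies the
-- reverse Cauchy–Schwarz inequality.  For l = 0 it is computed directly.  Otherwise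
-- write v₁ = Σ a_F x_F with a_F > 0, and let D be the matrix of the form in the
-- coordinates F, normalised by the a_F to have row sums 1.  The inequality on the
-- links of the F's gives D ≤ D² (Bochner's method), and 1 - D is a weighted graph
-- Laplacian, hence ≥ 0 with constant kernel because the graph of extensions of C is
-- connected.  So 1 is a simple eigenvalue of D and all others are ≤ 0.  Finally γ_k
-- is a limit of the ample classes γ_k + ε |S| (n + 1 - |S|).

module Submission where

open import Defs
open import Data.Bool using (true; false)
import Data.Bool.Properties as BoolP
open import Data.Empty using (⊥-elim) renaming (⊥ to False)
open import Data.Fin using (Fin; toℕ) renaming (zero to fzero; suc to fsuc)
open import Data.Fin.Properties using (¬∀⟶∃¬; toℕ<n)
open import Data.Fin.Subset using (Subset; inside; outside; _⊆_; _⊂_; _∪_; _∩_; ∣_∣; ⁅_⁆; ⊥; ⊤) renaming (_∈_ to _∈ˢ_; _∉_ to _∉ˢ_)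
open import Data.Fin.Subset.Properties
open import Data.Integer as ℤ using () renaming (+_ to pos)
import Data.Integer.Properties as ℤP
open import Data.List using (List; []; _∷_; map; filter; _++_; length; allFin; concatMap; replicate; foldr)
open import Data.List.Properties using (++-identityʳ; map-tabulate; length-++; length-replicate)
open import Data.List.Membership.Propositional using (_∈_)
open import Data.List.Membership.Propositional.Properties using (∈-map⁺; ∈-map⁻; ∈-++⁺ˡ; ∈-++⁺ʳ; ∈-filter⁺; ∈-filter⁻; ∈-allFin; ∈-∃++)
open import Data.List.Relation.Binary.Permutation.Propositional as Perm using (_↭_; prep; swap; ↭-refl; ↭-sym; ↭-trans)
open import Data.List.Relation.Binary.Permutation.Propositional.Properties using (All-resp-↭; ∈-resp-↭; ↭-length; shift; ++-comm)
open import Data.List.Relation.Unary.All as All using (All; []; _∷_)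
import Data.List.Relation.Unary.All.Properties as All
open import Data.List.Relation.Unary.AllPairs using (AllPairs; []; _∷_)
open import Data.List.Relation.Unary.Any using (here; there)
open import Data.List.Relation.Unary.Linked.Properties using (AllPairs⇒Linked)
open import Data.List.Relation.Unary.Unique.Propositional using (Unique)
import Data.List.Relation.Unary.Unique.Propositional.Properties as Unique
open import Data.Nat as ℕ using (ℕ; zero; suc; s≤s; z≤n)
import Data.Nat.Properties as ℕP
open import Data.Product using (∃; _×_; _,_; proj₁; proj₂)
open import Data.Rational using (ℚ; 0ℚ; 1ℚ; _+_; _*_; _-_; -_; _≤_; _<_; _/_; 1/_; positive; nonNegative; ≢-nonZero) renaming (∣_∣ to ∥_∥)
open import Data.Rational.Properties as ℚP using (_≟_)
open import Data.Rational.Solver using (module +-*-Solver)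
open +-*-Solver using (solve; _:+_; _:*_; _:-_; :-_; _:=_; con)
open import Data.Rational.Unnormalised as ℚᵘ using (mkℚᵘ; *≡*)
import Data.Rational.Unnormalised.Properties as ℚᵘP
open import Data.Sum using (_⊎_; inj₁; inj₂; [_,_]′)
import Data.Vec as Vec
open import Data.Vec.Properties using (≡-dec; ∷-injectiveʳ)
open import Relation.Binary.Definitions using (DecidableEquality; tri<; tri≈; tri>)
open import Relation.Binary.PropositionalEquality using (_≡_; _≢_; refl; sym; trans; cong; cong₂; subst; subst₂; module ≡-Reasoning)
open import Relation.Nullary using (¬_; Dec; yes; no; contradiction)
open import Relation.Nullary.Decidable using (_×-dec_; _⊎-dec_; _→-dec_; ¬?)
open import Relation.Unary using (Decidable)

-- Ordered field lemmas

-- The spectral picture behind the inductive step: `D ≤ D²` keeps eigenvalues out of (0,1), and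
-- positivity of the Laplacian keeps them out of (1,∞), so everything orthogonal to the constants
-- has eigenvalues at most 0. The eigenvalues of a rational matrix need not be rational, so no
-- diagonalisation is available over `ℚ`. Instead the kernel statement is used to solve (1 - D) x =
-- z for a given z orthogonal to the constants, and the two inequalities are combined at x and at x
-- - z. The induction closes because the reverse inequality is asymmetric: only one of its two
-- arguments has to be ample. On the link of F it is applied to an arbitrary vector and to the form
-- that was split off, which is ample there as well because ampleness quantifies over all chains.
-- The case of no ample factor is separate because there is then no form to distribute over the
-- links. The functional `L` is known only through its axioms, so every positivity statement is
-- traced back to flags having value 1.

0≤-diff : ∀ {p q} → p ≤ q → 0ℚ ≤ q - p
0≤-diff {p} {q} h = subst (_≤ q - p) (ℚP.+-inverseʳ p) (ℚP.+-monoˡ-≤ (- p) h)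

diff-0≤ : ∀ {p q} → 0ℚ ≤ q - p → p ≤ q
diff-0≤ {p} {q} h = subst₂ _≤_ (ℚP.+-identityˡ p)
  (solve 2 (λ q p → (q :- p) :+ p := q) refl q p) (ℚP.+-monoˡ-≤ p h)

diff-0< : ∀ {p q} → 0ℚ < q - p → p < q
diff-0< {p} {q} h = subst₂ _<_ (ℚP.+-identityˡ p)
  (solve 2 (λ q p → (q :- p) :+ p := q) refl q p) (ℚP.+-monoˡ-< p h)

0<-diff : ∀ {p q} → p < q → 0ℚ < q - p
0<-diff {p} {q} h = subst (_< q - p) (ℚP.+-inverseʳ p) (ℚP.+-monoˡ-< (- p) h)

0≤+ : ∀ {p q} → 0ℚ ≤ p → 0ℚ ≤ q → 0ℚ ≤ p + q
0≤+ = ℚP.+-mono-≤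

0<+ : ∀ {p q} → 0ℚ < p → 0ℚ ≤ q → 0ℚ < p + q
0<+ = ℚP.+-mono-<-≤

0≤* : ∀ {p q} → 0ℚ ≤ p → 0ℚ ≤ q → 0ℚ ≤ p * q
0≤* {p} {q} hp hq =
  subst (_≤ p * q) (ℚP.*-zeroʳ p) (ℚP.*-monoˡ-≤-nonNeg p {{nonNegative hp}} hq)

0<* : ∀ {p q} → 0ℚ < p → 0ℚ < q → 0ℚ < p * q
0<* {p} {q} hp hq =
  subst (_< p * q) (ℚP.*-zeroʳ p) (ℚP.*-monoʳ-<-pos p {{positive hp}} hq)

0≤sq : ∀ p → 0ℚ ≤ p * p
0≤sq p with ℚP.≤-total 0ℚ p
... | inj₁ h = 0≤* h h
... | inj₂ h = subst (0ℚ ≤_) (solve 1 (λ p → (:- p) :* (:- p) := p :* p) refl p)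
                 (0≤* (ℚP.neg-antimono-≤ h) (ℚP.neg-antimono-≤ h))

*-cancel-0≤ : ∀ {p q} → 0ℚ < p → 0ℚ ≤ p * q → 0ℚ ≤ q
*-cancel-0≤ {p} {q} hp h =
  ℚP.*-cancelˡ-≤-pos p {{positive hp}} (subst (_≤ p * q) (sym (ℚP.*-zeroʳ p)) h)

*-cancel-0< : ∀ {p q} → 0ℚ < p → 0ℚ < p * q → 0ℚ < q
*-cancel-0< {p} {q} hp h =
  ℚP.*-cancelˡ-<-nonNeg p {{nonNegative (ℚP.<⇒≤ hp)}} (subst (_< p * q) (sym (ℚP.*-zeroʳ p)) h)

*-zero-factor : ∀ {p q} → p ≢ 0ℚ → p * q ≡ 0ℚ → q ≡ 0ℚ
*-zero-factor {p} {q} p≢0 h = begin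
  q                      ≡⟨ sym (ℚP.*-identityˡ q) ⟩
  1ℚ * q                 ≡⟨ cong (_* q) (sym (ℚP.*-inverseˡ p {{nz}})) ⟩
  (1/ p) {{nz}} * p * q  ≡⟨ ℚP.*-assoc ((1/ p) {{nz}}) p q ⟩
  (1/ p) {{nz}} * (p * q) ≡⟨ cong ((1/ p) {{nz}} *_) h ⟩
  (1/ p) {{nz}} * 0ℚ     ≡⟨ ℚP.*-zeroʳ ((1/ p) {{nz}}) ⟩
  0ℚ ∎
  where
  open ≡-Reasoning
  nz = ≢-nonZero p≢0

difference : ∀ {p q} → p - q ≡ 0ℚ → p ≡ q
difference {p} {q} e = trans (solve 2 (λ p q → p := (p :- q) :+ q) refl p q) (trans (cong (_+ q) e) (ℚP.+-identityˡ q))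

sq-zero : ∀ {p} → p * p ≡ 0ℚ → p ≡ 0ℚ
sq-zero {p} h with p ≟ 0ℚ
... | yes e = e
... | no ne = *-zero-factor ne h

-- Total reciprocal; its value at 0 is junk.
recip : ℚ → ℚ
recip p with p ≟ 0ℚ
... | yes _ = 0ℚ
... | no ne = (1/ p) {{≢-nonZero ne}}

recip-inverse : ∀ {p} → p ≢ 0ℚ → p * recip p ≡ 1ℚ
recip-inverse {p} ne with p ≟ 0ℚ
... | yes e = contradiction e ne
... | no ne′ = ℚP.*-inverseʳ p {{≢-nonZero ne′}}

0<⇒≢0 : ∀ {p} → 0ℚ < p → p ≢ 0ℚ
0<⇒≢0 h e = ℚP.<⇒≢ h (sym e)

-- xx + c xy + c (xy + c yy) is the square of the vector x + c y.
discriminant : ∀ c xx xy yy → 0ℚ < yy → xx + c * xy + c * (xy + c * yy) ≤ 0ℚ → xx * yy ≤ xy * xy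
discriminant c xx xy yy 0<yy h = diff-0≤ (subst (0ℚ ≤_) eq
    (0≤+ (0≤* (ℚP.<⇒≤ 0<yy) (0≤-diff h)) (0≤sq (xy + c * yy))))
  where
  eq : yy * (0ℚ - (xx + c * xy + c * (xy + c * yy))) + (xy + c * yy) * (xy + c * yy) ≡ xy * xy - xx * yy
  eq = solve 4 (λ c xx xy yy →
         yy :* (con 0ℚ :- (xx :+ c :* xy :+ c :* (xy :+ c :* yy))) :+ (xy :+ c :* yy) :* (xy :+ c :* yy)
         := xy :* xy :- xx :* yy) refl c xx xy yy

-- This stands in for continuity at ε = 0. A negative `a` is refuted by the single value ε = -a /
-- (-a + |b| + |c|), which is at most 1, so that ε² can be bounded by ε.
0≤-limit : ∀ a b c → (∀ ε → 0ℚ < ε → 0ℚ ≤ a + ε * b + ε * ε * c) → 0ℚ ≤ a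
0≤-limit a b c h with 0ℚ ℚP.≤? a
... | yes p = p
... | no np = contradiction final (ℚP.<-irrefl refl)
  where
  n : ℚ
  n = - a
  0<n : 0ℚ < n
  0<n = ℚP.neg-antimono-< (ℚP.≰⇒> np)
  k : ℚ
  k = ∥ b ∥ + ∥ c ∥
  0≤k : 0ℚ ≤ k
  0≤k = 0≤+ (ℚP.0≤∣p∣ b) (ℚP.0≤∣p∣ c)
  D : ℚ
  D = n + k
  0<D : 0ℚ < D
  0<D = 0<+ 0<n 0≤k
  R : ℚ
  R = recip D
  DR : D * R ≡ 1ℚ
  DR = recip-inverse (0<⇒≢0 0<D)
  p≤∣p∣ : ∀ p → 0ℚ ≤ ∥ p ∥ - p
  p≤∣p∣ p with ℚP.≤-total 0ℚ p
  ... | inj₁ q = subst (0ℚ ≤_) (sym (trans (cong (_- p) (ℚP.0≤p⇒∣p∣≡p q)) (ℚP.+-inverseʳ p))) ℚP.≤-refl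
  ... | inj₂ q = 0≤+ (ℚP.0≤∣p∣ p) (ℚP.neg-antimono-≤ q)
  0<R : 0ℚ < R
  0<R = *-cancel-0< 0<D (subst (0ℚ <_) (sym DR) (ℚP.positive⁻¹ 1ℚ))
  ε : ℚ
  ε = n * R
  0<ε : 0ℚ < ε
  0<ε = 0<* 0<n 0<R
  1-ε : 1ℚ - ε ≡ k * R
  1-ε = trans (cong (_- ε) (sym DR))
    (solve 3 (λ n k R → (n :+ k) :* R :- n :* R := k :* R) refl n k R)
  0≤1-ε : 0ℚ ≤ 1ℚ - ε
  0≤1-ε = subst (0ℚ ≤_) (sym 1-ε) (0≤* 0≤k (ℚP.<⇒≤ 0<R))
  -- a + ε b + ε² c ≤ a + ε k = a ε < 0
  upper : 0ℚ ≤ a * ε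
  upper = subst (0ℚ ≤_) eq
    (0≤+ (0≤+ (0≤+ (h ε 0<ε) (0≤* (ℚP.<⇒≤ 0<ε) (p≤∣p∣ b)))
         (0≤* (0≤sq ε) (p≤∣p∣ c)))
         (0≤* (0≤* (ℚP.<⇒≤ 0<ε) 0≤1-ε) (ℚP.0≤∣p∣ c)))
    where
    open ≡-Reasoning
    eq : (a + ε * b + ε * ε * c) + ε * (∥ b ∥ - b) + ε * ε * (∥ c ∥ - c)
           + ε * (1ℚ - ε) * ∥ c ∥ ≡ a * ε
    eq = begin
      (a + ε * b + ε * ε * c) + ε * (∥ b ∥ - b) + ε * ε * (∥ c ∥ - c) + ε * (1ℚ - ε) * ∥ c ∥
        ≡⟨ solve 6 (λ a b c e B C →
             (a :+ e :* b :+ e :* e :* c) :+ e :* (B :- b) :+ e :* e :* (C :- c)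
               :+ e :* (con 1ℚ :- e) :* C := a :+ e :* (B :+ C)) refl a b c ε ∥ b ∥ ∥ c ∥ ⟩
      a + ε * k
        ≡⟨ solve 4 (λ a k R e → a :+ e :* k := a :+ (:- a :* (k :* R)) :+ (e :* k :- (:- a :* R) :* k)) refl a k R ε ⟩
      a + n * (k * R) + (ε * k - n * R * k)
        ≡⟨ cong₂ _+_ (cong (λ t → a + n * t) (sym 1-ε)) (ℚP.+-inverseʳ (ε * k)) ⟩
      a + n * (1ℚ - ε) + 0ℚ
        ≡⟨ solve 2 (λ a e → a :+ :- a :* (con 1ℚ :- e) :+ con 0ℚ := a :* e) refl a ε ⟩
      a * ε ∎
  final : 0ℚ < 0ℚ
  final = subst (0ℚ <_) (solve 2 (λ a e → :- a :* e :+ a :* e := con 0ℚ) refl a ε)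
            (0<+ (0<* 0<n 0<ε) upper)

-- Finite sums

module _ {A : Set} where

  Σ-cong : ∀ (xs : List A) {f g : A → ℚ} → (∀ {x} → x ∈ xs → f x ≡ g x) → Σℚ xs f ≡ Σℚ xs g
  Σ-cong [] h = refl
  Σ-cong (x ∷ xs) h = cong₂ _+_ (h (here refl)) (Σ-cong xs (λ p → h (there p)))

  Σ-zero : ∀ (xs : List A) {f : A → ℚ} → (∀ {x} → x ∈ xs → f x ≡ 0ℚ) → Σℚ xs f ≡ 0ℚ
  Σ-zero [] h = refl
  Σ-zero (x ∷ xs) h = trans (cong₂ _+_ (h (here refl)) (Σ-zero xs (λ p → h (there p)))) (ℚP.+-identityˡ 0ℚ)

  Σ-+ : ∀ (xs : List A) (f g : A → ℚ) → Σℚ xs (λ x → f x + g x) ≡ Σℚ xs f + Σℚ xs g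
  Σ-+ [] f g = sym (ℚP.+-identityˡ 0ℚ)
  Σ-+ (x ∷ xs) f g = trans (cong ((f x + g x) +_) (Σ-+ xs f g))
    (solve 4 (λ a b c d → (a :+ b) :+ (c :+ d) := (a :+ c) :+ (b :+ d)) refl (f x) (g x) (Σℚ xs f) (Σℚ xs g))

  Σ-* : ∀ (xs : List A) (c : ℚ) (f : A → ℚ) → Σℚ xs (λ x → c * f x) ≡ c * Σℚ xs f
  Σ-* [] c f = sym (ℚP.*-zeroʳ c)
  Σ-* (x ∷ xs) c f = trans (cong (c * f x +_) (Σ-* xs c f)) (sym (ℚP.*-distribˡ-+ c (f x) (Σℚ xs f)))

  Σ-- : ∀ (xs : List A) (f g : A → ℚ) → Σℚ xs (λ x → f x - g x) ≡ Σℚ xs f - Σℚ xs g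
  Σ-- [] f g = refl
  Σ-- (x ∷ xs) f g = trans (cong ((f x - g x) +_) (Σ-- xs f g))
    (solve 4 (λ a b c d → (a :- b) :+ (c :- d) := (a :+ c) :- (b :+ d)) refl (f x) (g x) (Σℚ xs f) (Σℚ xs g))

  Σ-nonneg : ∀ (xs : List A) {f : A → ℚ} → (∀ {x} → x ∈ xs → 0ℚ ≤ f x) → 0ℚ ≤ Σℚ xs f
  Σ-nonneg [] h = ℚP.≤-refl
  Σ-nonneg (x ∷ xs) h = 0≤+ (h (here refl)) (Σ-nonneg xs (λ p → h (there p)))

  Σ-mono : ∀ (xs : List A) {f g : A → ℚ} → (∀ {x} → x ∈ xs → f x ≤ g x) → Σℚ xs f ≤ Σℚ xs g
  Σ-mono [] h = ℚP.≤-refl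
  Σ-mono (x ∷ xs) h = ℚP.+-mono-≤ (h (here refl)) (Σ-mono xs (λ p → h (there p)))

  Σ-pos : ∀ (xs : List A) {f : A → ℚ} → (∀ {x} → x ∈ xs → 0ℚ ≤ f x) →
          ∀ {y} → y ∈ xs → 0ℚ < f y → 0ℚ < Σℚ xs f
  Σ-pos (x ∷ xs) h (here refl) hy = 0<+ hy (Σ-nonneg xs (λ p → h (there p)))
  Σ-pos (x ∷ xs) h (there p) hy = ℚP.+-mono-≤-< (h (here refl)) (Σ-pos xs (λ p → h (there p)) p hy)

  Σ-nonneg-zero : ∀ (xs : List A) {f : A → ℚ} → (∀ {x} → x ∈ xs → 0ℚ ≤ f x) →
                  Σℚ xs f ≡ 0ℚ → ∀ {y} → y ∈ xs → f y ≡ 0ℚ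
  Σ-nonneg-zero xs h s p =
    ℚP.≤-antisym (ℚP.≮⇒≥ (λ q → 0<⇒≢0 (Σ-pos xs h p q) s)) (h p)

  Σ-filter : ∀ {P : A → Set} (P? : Decidable P) (xs : List A) {f : A → ℚ} →
             (∀ {x} → x ∈ xs → ¬ P x → f x ≡ 0ℚ) → Σℚ xs f ≡ Σℚ (filter P? xs) f
  Σ-filter P? [] h = refl
  Σ-filter P? (x ∷ xs) {f} h with P? x
  ... | yes _ = cong (f x +_) (Σ-filter P? xs (λ p → h (there p)))
  ... | no np = trans (cong₂ _+_ (h (here refl) np) (Σ-filter P? xs (λ p → h (there p)))) (ℚP.+-identityˡ _)

  Σ-const-* : ∀ (xs : List A) (f g : A → ℚ) → (∀ {x y} → x ∈ xs → y ∈ xs → f x ≡ f y) →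
              Σℚ xs g ≡ 0ℚ → Σℚ xs (λ x → f x * g x) ≡ 0ℚ
  Σ-const-* [] f g h s = refl
  Σ-const-* xs@(y ∷ _) f g h s =
    trans (Σ-cong xs (λ {x} p → cong (_* g x) (h p (here refl))))
      (trans (Σ-* xs (f y) g) (trans (cong (f y *_) s) (ℚP.*-zeroʳ (f y))))

  Σ-single : ∀ {xs : List A} {f : A → ℚ} → Unique xs → ∀ {y} → y ∈ xs →
             (∀ {x} → x ∈ xs → x ≢ y → f x ≡ 0ℚ) → Σℚ xs f ≡ f y
  Σ-single {xs = x ∷ xs} {f} (x∉ ∷ _) (here refl) h =
    trans (cong (f x +_) (Σ-zero xs (λ p → h (there p) (λ e → All.lookup x∉ p (sym e))))) (ℚP.+-identityʳ (f x))
  Σ-single {xs = x ∷ xs} {f} (x∉ ∷ u) {y} (there p) h =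
    trans (cong₂ _+_ (h (here refl) (All.lookup x∉ p)) (Σ-single u p (λ q → h (there q)))) (ℚP.+-identityˡ (f y))

Σ-swap : ∀ {A B : Set} (xs : List A) (ys : List B) (f : A → B → ℚ) →
         Σℚ xs (λ x → Σℚ ys (f x)) ≡ Σℚ ys (λ y → Σℚ xs (λ x → f x y))
Σ-swap [] ys f = sym (Σ-zero ys (λ _ → refl))
Σ-swap (x ∷ xs) ys f =
  trans (cong (Σℚ ys (f x) +_) (Σ-swap xs ys f))
        (sym (Σ-+ ys (f x) (λ y → Σℚ xs (λ x → f x y))))

-- Linear algebra on functions restricted to a finite list N of coordinates

module Coordinates {I : Set} (N : List I) where

  ⟨_,_⟩ : (I → ℚ) → (I → ℚ) → ℚ
  ⟨ x , y ⟩ = Σℚ N (λ F → x F * y F)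

  ⟨⟩-comm : ∀ x y → ⟨ x , y ⟩ ≡ ⟨ y , x ⟩
  ⟨⟩-comm x y = Σ-cong N (λ {F} _ → ℚP.*-comm (x F) (y F))

  ⟨⟩-+* : ∀ x y c z → ⟨ x , (λ F → y F + c * z F) ⟩ ≡ ⟨ x , y ⟩ + c * ⟨ x , z ⟩
  ⟨⟩-+* x y c z = begin
    Σℚ N (λ F → x F * (y F + c * z F))
      ≡⟨ Σ-cong N (λ {F} _ → solve 4 (λ x y c z → x :* (y :+ c :* z) := x :* y :+ c :* (x :* z)) refl (x F) (y F) c (z F)) ⟩
    Σℚ N (λ F → x F * y F + c * (x F * z F))
      ≡⟨ Σ-+ N _ _ ⟩
    ⟨ x , y ⟩ + Σℚ N (λ F → c * (x F * z F))
      ≡⟨ cong (⟨ x , y ⟩ +_) (Σ-* N c _) ⟩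
    ⟨ x , y ⟩ + c * ⟨ x , z ⟩ ∎
    where open ≡-Reasoning

  ⟨⟩-+*ˡ : ∀ x y c z → ⟨ (λ F → y F + c * z F) , x ⟩ ≡ ⟨ y , x ⟩ + c * ⟨ z , x ⟩
  ⟨⟩-+*ˡ x y c z = trans (⟨⟩-comm _ x) (trans (⟨⟩-+* x y c z)
    (cong₂ (λ s t → s + c * t) (⟨⟩-comm x y) (⟨⟩-comm x z)))

  ⟨⟩-congʳ : ∀ x {y z} → (∀ {F} → F ∈ N → y F ≡ z F) → ⟨ x , y ⟩ ≡ ⟨ x , z ⟩
  ⟨⟩-congʳ x h = Σ-cong N (λ {F} p → cong (x F *_) (h p))

  -- The Fredholm alternative, by elimination on the list bs.  The first case
  -- records that x is (up to the annihilators of Λ bs) in the span of bs.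
  module _ (Λ : (I → ℚ) → I → ℚ)
           (Λ-0 : ∀ F → Λ (λ _ → 0ℚ) F ≡ 0ℚ)
           (Λ-+* : ∀ x c y F → Λ (λ G → x G + c * y G) F ≡ Λ x F + c * Λ y F) where

    Kills : (I → ℚ) → List (I → ℚ) → Set
    Kills φ = All (λ b → ⟨ φ , Λ b ⟩ ≡ 0ℚ)

    fredholm : ∀ bs y →
      (∃ λ x → (∀ {F} → F ∈ N → Λ x F ≡ y F) × (∀ φ → Kills φ bs → ⟨ φ , Λ x ⟩ ≡ 0ℚ))
      ⊎ (∃ λ φ → Kills φ bs × ⟨ φ , y ⟩ ≢ 0ℚ)
    fredholm [] y with ⟨ y , y ⟩ ≟ 0ℚ
    ... | no ne = inj₂ (y , [] , ne)
    ... | yes e = inj₁ ((λ _ → 0ℚ)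
                       , (λ {F} p → trans (Λ-0 F) (sym (sq-zero (Σ-nonneg-zero N (λ {G} _ → 0≤sq (y G)) e p))))
                       , (λ φ _ → Σ-zero N (λ {F} _ → trans (cong (φ F *_) (Λ-0 F)) (ℚP.*-zeroʳ (φ F)))))
    fredholm (b ∷ bs) y with fredholm bs (Λ b)
    ... | inj₁ (x , eq , kill) with fredholm bs y
    ...   | inj₁ (x′ , eq′ , kill′) = inj₁ (x′ , eq′ , λ { φ (_ ∷ k) → kill′ φ k })
    ...   | inj₂ (φ , k , ne) = inj₂ (φ , (trans (sym (⟨⟩-congʳ φ eq)) (kill φ k)) ∷ k , ne)
    -- `w` detects `Λ b` but none of the images of `bs`, so `y` is first made orthogonal to `w` by
    -- subtracting a multiple of `Λ b`. An obstruction `u` to the corrected problem turns into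
    -- `u′ = u + c w`, which also kills `Λ b` and pairs with `y` as `u` does with the corrected
    -- vector.
    fredholm (b ∷ bs) y | inj₂ (w , kw , wn) with fredholm bs (λ F → y F + (- (⟨ w , y ⟩ * recip ⟨ w , Λ b ⟩)) * Λ b F)
    ...   | inj₁ (x , eq , kill) =
              inj₁ ( (λ F → x F + c * b F)
                   , (λ {F} p → trans (Λ-+* x c b F) (trans (cong (_+ c * Λ b F) (eq p))
                         (solve 3 (λ y c l → (y :+ :- c :* l) :+ c :* l := y) refl (y F) c (Λ b F))))
                   , λ { φ (k ∷ ks) → trans (⟨⟩-congʳ φ (λ {F} _ → Λ-+* x c b F))
                          (trans (⟨⟩-+* φ (Λ x) c (Λ b))
                            (trans (cong₂ (λ s t → s + c * t) (kill φ ks) k)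
                              (trans (cong (0ℚ +_) (ℚP.*-zeroʳ c)) (ℚP.+-identityˡ 0ℚ)))) })
      where
      c : ℚ
      c = ⟨ w , y ⟩ * recip ⟨ w , Λ b ⟩
    ...   | inj₂ (u , ku , un) = inj₂ (u′ , kb ∷ kbs ku kw , λ e → un (trans (⟨⟩-+* u y (- (⟨ w , y ⟩ * ρ)) (Λ b)) (trans eqv e)))
      where
      ρ c : ℚ
      ρ = recip ⟨ w , Λ b ⟩
      c = - (⟨ u , Λ b ⟩ * ρ)
      u′ : I → ℚ
      u′ F = u F + c * w F
      kb : ⟨ u′ , Λ b ⟩ ≡ 0ℚ
      kb = trans (⟨⟩-+*ˡ (Λ b) u c w)
             (trans (solve 3 (λ U W r → U :+ (:- (U :* r)) :* W := U :* (con 1ℚ :- W :* r)) refl ⟨ u , Λ b ⟩ ⟨ w , Λ b ⟩ ρ)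
             (trans (cong (λ t → ⟨ u , Λ b ⟩ * (1ℚ - t)) (recip-inverse wn))
             (ℚP.*-zeroʳ ⟨ u , Λ b ⟩)))
      kbs : ∀ {bs} → Kills u bs → Kills w bs → Kills u′ bs
      kbs [] [] = []
      kbs {b′ ∷ _} (p ∷ ps) (q ∷ qs) =
        trans (⟨⟩-+*ˡ (Λ b′) u c w) (trans (cong₂ (λ s t → s + c * t) p q)
          (trans (cong (0ℚ +_) (ℚP.*-zeroʳ c)) (ℚP.+-identityˡ 0ℚ))) ∷ kbs ps qs
      eqv : ⟨ u , y ⟩ + (- (⟨ w , y ⟩ * ρ)) * ⟨ u , Λ b ⟩ ≡ ⟨ u′ , y ⟩
      eqv = trans (solve 4 (λ a b c d → a :+ (:- (b :* c)) :* d := a :+ (:- (d :* c)) :* b) refl ⟨ u , y ⟩ ⟨ w , y ⟩ ρ ⟨ u , Λ b ⟩)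
              (sym (⟨⟩-+*ˡ y u c w))

-- Weighted graph Laplacians

module Laplacian {I : Set} (_≟ᴵ_ : DecidableEquality I) (N : List I)
  (W : I → I → ℚ) (W-sym : ∀ F G → W F G ≡ W G F)
  (W-nonneg : ∀ {F G} → F ∈ N → G ∈ N → F ≢ G → 0ℚ ≤ W F G) where

  open Coordinates N

  w : (I → ℚ) → I → ℚ
  w x F = Σℚ N (λ G → W F G * x G)

  d : I → ℚ
  d F = Σℚ N (W F)

  Λ : (I → ℚ) → I → ℚ
  Λ x F = d F * x F - w x F

  w-+* : ∀ x c y F → w (λ G → x G + c * y G) F ≡ w x F + c * w y F
  w-+* x c y F = ⟨⟩-+* (W F) x c y

  Λ-0 : ∀ F → Λ (λ _ → 0ℚ) F ≡ 0ℚ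
  Λ-0 F = trans (cong₂ _-_ (ℚP.*-zeroʳ (d F)) (Σ-zero N (λ {G} _ → ℚP.*-zeroʳ (W F G)))) (ℚP.+-inverseʳ 0ℚ)

  Λ-+* : ∀ x c y F → Λ (λ G → x G + c * y G) F ≡ Λ x F + c * Λ y F
  Λ-+* x c y F = trans (cong (λ t → d F * (x F + c * y F) - t) (w-+* x c y F))
    (solve 6 (λ d x c y p q → d :* (x :+ c :* y) :- (p :+ c :* q) := (d :* x :- p) :+ c :* (d :* y :- q))
      refl (d F) (x F) c (y F) (w x F) (w y F))

  w-adjoint : ∀ x y → ⟨ x , w y ⟩ ≡ ⟨ y , w x ⟩
  w-adjoint x y = begin
    Σℚ N (λ F → x F * Σℚ N (λ G → W F G * y G))
      ≡⟨ Σ-cong N (λ {F} _ → sym (Σ-* N (x F) _)) ⟩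
    Σℚ N (λ F → Σℚ N (λ G → x F * (W F G * y G)))
      ≡⟨ Σ-swap N N _ ⟩
    Σℚ N (λ G → Σℚ N (λ F → x F * (W F G * y G)))
      ≡⟨ Σ-cong N (λ {G} _ → Σ-cong N (λ {F} _ → trans (cong (λ t → x F * (t * y G)) (W-sym F G))
           (solve 3 (λ a b c → a :* (b :* c) := c :* (b :* a)) refl (x F) (W G F) (y G)))) ⟩
    Σℚ N (λ G → Σℚ N (λ F → y G * (W G F * x F)))
      ≡⟨ Σ-cong N (λ {G} _ → Σ-* N (y G) _) ⟩
    Σℚ N (λ G → y G * Σℚ N (λ F → W G F * x F)) ∎
    where open ≡-Reasoning

  ⟨⟩-Λ : ∀ x y → ⟨ x , Λ y ⟩ ≡ Σℚ N (λ F → d F * (x F * y F)) - ⟨ x , w y ⟩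
  ⟨⟩-Λ x y = trans (Σ-cong N (λ {F} _ → solve 4 (λ x d y p → x :* (d :* y :- p) := d :* (x :* y) :- x :* p) refl (x F) (d F) (y F) (w y F)))
    (Σ-- N _ _)

  Λ-adjoint : ∀ x y → ⟨ x , Λ y ⟩ ≡ ⟨ y , Λ x ⟩
  Λ-adjoint x y = trans (⟨⟩-Λ x y) (trans (cong₂ _-_
    (Σ-cong N (λ {F} _ → cong (d F *_) (ℚP.*-comm (x F) (y F)))) (w-adjoint x y)) (sym (⟨⟩-Λ y x)))

  edge : (I → ℚ) → I → I → ℚ
  edge x F G = W F G * ((x F - x G) * (x F - x G))

  -- Ordered pairs count every edge twice. The diagonal entries `W F F` cancel, which is why
  -- nonnegativity of `W` is asked only off the diagonal; in the application they are
  -- self-intersections of unknown sign.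
  energy : ∀ x → Σℚ N (λ F → Σℚ N (edge x F)) ≡ ⟨ x , Λ x ⟩ + ⟨ x , Λ x ⟩
  energy x = begin
    Σℚ N (λ F → Σℚ N (edge x F))
      ≡⟨ Σ-cong N (λ {F} _ → Σ-cong N (λ {G} _ → solve 3 (λ w a b →
           w :* ((a :- b) :* (a :- b)) := (w :* (a :* a) :- a :* (w :* b)) :+ (w :* (b :* b) :- a :* (w :* b))) refl (W F G) (x F) (x G))) ⟩
    Σℚ N (λ F → Σℚ N (λ G → h F G + k F G))
      ≡⟨ Σ-cong N (λ {F} _ → Σ-+ N (h F) (k F)) ⟩
    Σℚ N (λ F → Σℚ N (h F) + Σℚ N (k F))
      ≡⟨ Σ-+ N _ _ ⟩
    Σℚ N (λ F → Σℚ N (h F)) + Σℚ N (λ F → Σℚ N (k F))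
      ≡⟨ cong₂ _+_ (Σ-cong N (λ {F} _ → h-sum F)) (trans (Σ-swap N N k) (Σ-cong N (λ {G} _ → trans (Σ-cong N (λ {F} _ → k-h F G)) (h-sum G)))) ⟩
    ⟨ x , Λ x ⟩ + ⟨ x , Λ x ⟩ ∎
    where
    open ≡-Reasoning
    h k : I → I → ℚ
    h F G = W F G * (x F * x F) - x F * (W F G * x G)
    k F G = W F G * (x G * x G) - x F * (W F G * x G)
    k-h : ∀ F G → k F G ≡ h G F
    k-h F G = trans (cong (λ t → t * (x G * x G) - x F * (t * x G)) (W-sym F G))
      (solve 3 (λ w a b → w :* (b :* b) :- a :* (w :* b) := w :* (b :* b) :- b :* (w :* a)) refl (W G F) (x F) (x G))
    h-sum : ∀ F → Σℚ N (h F) ≡ x F * Λ x F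
    h-sum F = trans (Σ-- N _ _) (trans (cong₂ _-_
        (trans (Σ-cong N (λ {G} _ → ℚP.*-comm (W F G) (x F * x F))) (Σ-* N (x F * x F) (W F)))
        (Σ-* N (x F) _))
      (solve 3 (λ x d w → x :* x :* d :- x :* w := x :* (d :* x :- w)) refl (x F) (d F) (w x F)))

  edge-nonneg : ∀ x {F G} → F ∈ N → G ∈ N → 0ℚ ≤ edge x F G
  edge-nonneg x {F} {G} p q with F ≟ᴵ G
  ... | yes refl = ℚP.≤-reflexive (sym (trans (cong (λ t → W F F * (t * t)) (ℚP.+-inverseʳ (x F))) (ℚP.*-zeroʳ (W F F))))
  ... | no ne = 0≤* (W-nonneg p q ne) (0≤sq (x F - x G))

  Λ-nonneg : ∀ x → 0ℚ ≤ ⟨ x , Λ x ⟩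
  Λ-nonneg x = ℚP.≮⇒≥ λ neg → ℚP.<-irrefl refl (ℚP.<-≤-trans (ℚP.+-mono-< neg neg)
    (subst (0ℚ ≤_) (energy x) (Σ-nonneg N (λ p → Σ-nonneg N (edge-nonneg x p)))))

  δ : I → I → ℚ
  δ F G with F ≟ᴵ G
  ... | yes _ = 1ℚ
  ... | no _ = 0ℚ

  δ-nonneg : ∀ F G → 0ℚ ≤ δ F G
  δ-nonneg F G with F ≟ᴵ G
  ... | yes _ = ℚP.nonNegative⁻¹ 1ℚ
  ... | no _ = ℚP.≤-refl

  δ-diag : ∀ F → 0ℚ < δ F F
  δ-diag F with F ≟ᴵ F
  ... | yes _ = ℚP.positive⁻¹ 1ℚ
  ... | no ne = contradiction refl ne

  δ-subst : ∀ (f : I → ℚ) F G → δ F G * f G ≡ f F * δ F G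
  δ-subst f F G with F ≟ᴵ G
  ... | yes refl = ℚP.*-comm 1ℚ (f F)
  ... | no _ = trans (ℚP.*-zeroˡ (f G)) (sym (ℚP.*-zeroʳ (f F)))

  -- The list `N` may repeat `F`, so the pairing is `f F` times a multiplicity, of which only
  -- positivity is known.
  ⟨δ⟩-zero : ∀ f {F} → F ∈ N → ⟨ δ F , f ⟩ ≡ 0ℚ → f F ≡ 0ℚ
  ⟨δ⟩-zero f {F} p h = *-zero-factor (0<⇒≢0 (Σ-pos N (λ {G} _ → δ-nonneg F G) p (δ-diag F)))
    (trans (ℚP.*-comm (Σℚ N (δ F)) (f F))
      (trans (sym (Σ-* N (f F) (δ F))) (trans (Σ-cong N (λ {G} _ → sym (δ-subst f F G))) h)))

  -- Connectedness is expressed through functions that are constant along edges: this is how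
  -- harmonicity exploits it, and it lets a path be given as a chain of equalities.
  module Connected
    (connected : ∀ (u : I → ℚ) → (∀ {F G} → F ∈ N → G ∈ N → F ≢ G → 0ℚ < W F G → u F ≡ u G) →
                 ∀ {F G} → F ∈ N → G ∈ N → u F ≡ u G) where

    -- A harmonic function has energy 0, so every edge term vanishes and values agree across each
    -- edge of positive weight.
    harmonic-constant : ∀ φ → (∀ {F} → F ∈ N → Λ φ F ≡ 0ℚ) → ∀ {F G} → F ∈ N → G ∈ N → φ F ≡ φ G
    harmonic-constant φ h = connected φ λ {F} {G} p q _ 0<W →
      difference (sq-zero {φ F - φ G} (*-zero-factor {W F G} (0<⇒≢0 0<W) (edge-zero p q)))
      where
      zero-pairing : ⟨ φ , Λ φ ⟩ ≡ 0ℚ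
      zero-pairing = Σ-zero N (λ {F} p → trans (cong (φ F *_) (h p)) (ℚP.*-zeroʳ (φ F)))
      total : Σℚ N (λ F → Σℚ N (edge φ F)) ≡ 0ℚ
      total = trans (energy φ) (trans (cong₂ _+_ zero-pairing zero-pairing) (ℚP.+-identityˡ 0ℚ))
      edge-zero : ∀ {F G} → F ∈ N → G ∈ N → edge φ F G ≡ 0ℚ
      edge-zero {F} {G} p q = Σ-nonneg-zero N {edge φ F} (edge-nonneg φ p)
        (Σ-nonneg-zero N {λ F → Σℚ N (edge φ F)} (λ p → Σ-nonneg N (edge-nonneg φ p)) total p) q

    -- A Fredholm obstruction kills the images of all point masses. By self-adjointness it is
    -- harmonic, hence constant, and so it pairs to 0 with a vector of sum 0.
    Λ-solve : ∀ y → Σℚ N y ≡ 0ℚ → ∃ λ x → ∀ {F} → F ∈ N → Λ x F ≡ y F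
    Λ-solve y s = [ (λ (x , eq , _) → x , λ {F} → eq {F}) , (λ (φ , k , ne) →
        contradiction (Σ-const-* N φ y (harmonic-constant φ (harmonic φ k)) s) ne) ]′
        (fredholm Λ Λ-0 Λ-+* (map δ N) y)
      where
      harmonic : ∀ φ → Kills Λ Λ-0 Λ-+* φ (map δ N) → ∀ {F} → F ∈ N → Λ φ F ≡ 0ℚ
      harmonic φ k {F} p = ⟨δ⟩-zero (Λ φ) p (trans (Λ-adjoint (δ F) φ) (All.lookup k (∈-map⁺ δ p)))

    -- With S = d⁻¹ Λ and z = S x, the hypothesis says ⟨x,z⟩ ≤ ⟨z,z⟩ in the
    -- d-weighted pairing; expanding the energy of x - z then gives
    -- ⟨z,Sz⟩ ≥ 2⟨z,z⟩ - ⟨x,z⟩ ≥ ⟨z,z⟩.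
    w-nonpos :
      (∀ x y → (∀ {F} → F ∈ N → w x F ≡ d F * y F) → ⟨ x , w x ⟩ ≤ Σℚ N (λ F → d F * (y F * y F))) →
      ∀ z → Σℚ N (λ F → d F * z F) ≡ 0ℚ → ⟨ z , w z ⟩ ≤ 0ℚ
    w-nonpos bochner z s = diff-0≤ (subst (0ℚ ≤_) eq (0≤+ (0≤-diff (bochner x y wx)) (Λ-nonneg y)))
      where
      solution = Λ-solve (λ F → d F * z F) s
      x : I → ℚ
      x = proj₁ solution
      Λx : ∀ {F} → F ∈ N → Λ x F ≡ d F * z F
      Λx = proj₂ solution
      -- This is `D x`, characterised by `w x = d y` so that nothing has to be divided by `d`.
      y : I → ℚ
      y F = x F + (- 1ℚ) * z F
      _∙_ : (I → ℚ) → (I → ℚ) → ℚ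
      a ∙ b = Σℚ N (λ F → d F * (a F * b F))
      wx : ∀ {F} → F ∈ N → w x F ≡ d F * y F
      wx {F} p = trans (solve 3 (λ d x w → w := d :* x :- (d :* x :- w)) refl (d F) (x F) (w x F))
        (trans (cong (λ t → d F * x F - t) (Λx p)) (solve 3 (λ d x z → d :* x :- d :* z := d :* (x :+ con (- 1ℚ) :* z)) refl (d F) (x F) (z F)))
      pair : ∀ a → ⟨ a , Λ x ⟩ ≡ (a ∙ z)
      pair a = Σ-cong N (λ {F} p → trans (cong (a F *_) (Λx p))
        (solve 3 (λ a d z → a :* (d :* z) := d :* (a :* z)) refl (a F) (d F) (z F)))
      yy : (y ∙ y) ≡ (x ∙ x) - (x ∙ z) + ((z ∙ z) - (x ∙ z))
      yy = trans (Σ-cong N (λ {F} _ → solve 3 (λ d x z → d :* ((x :+ con (- 1ℚ) :* z) :* (x :+ con (- 1ℚ) :* z))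
               := (d :* (x :* x) :- d :* (x :* z)) :+ (d :* (z :* z) :- d :* (x :* z))) refl (d F) (x F) (z F)))
             (trans (Σ-+ N _ _) (cong₂ _+_ (Σ-- N _ _) (Σ-- N _ _)))
      xwx : ⟨ x , w x ⟩ ≡ (x ∙ x) - (x ∙ z)
      xwx = trans (solve 2 (λ a b → b := a :- (a :- b)) refl (x ∙ x) ⟨ x , w x ⟩)
        (cong (λ t → (x ∙ x) - t) (trans (sym (⟨⟩-Λ x x)) (pair x)))
      yΛy : ⟨ y , Λ y ⟩ ≡ ((x ∙ z) + (- 1ℚ) * (z ∙ z)) + (- 1ℚ) * ((z ∙ z) + (- 1ℚ) * ((z ∙ z) - ⟨ z , w z ⟩))
      yΛy = trans (⟨⟩-congʳ y (λ {F} _ → Λ-+* x (- 1ℚ) z F)) (trans (⟨⟩-+* y (Λ x) (- 1ℚ) (Λ z))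
        (cong₂ (λ p q → p + (- 1ℚ) * q)
          (trans (⟨⟩-+*ˡ (Λ x) x (- 1ℚ) z) (cong₂ (λ p q → p + (- 1ℚ) * q) (pair x) (pair z)))
          (trans (⟨⟩-+*ˡ (Λ z) x (- 1ℚ) z) (cong₂ (λ p q → p + (- 1ℚ) * q) (trans (Λ-adjoint x z) (pair z)) (⟨⟩-Λ z z)))))
      eq : ((y ∙ y) - ⟨ x , w x ⟩) + ⟨ y , Λ y ⟩ ≡ 0ℚ - ⟨ z , w z ⟩
      eq = trans (cong₂ _+_ (cong₂ _-_ yy xwx) yΛy)
        (solve 4 (λ xx xz zz q → ((xx :- xz :+ (zz :- xz)) :- (xx :- xz))
            :+ ((xz :+ con (- 1ℚ) :* zz) :+ con (- 1ℚ) :* (zz :+ con (- 1ℚ) :* (zz :- q)))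
            := con 0ℚ :- q) refl (x ∙ x) (x ∙ z) (z ∙ z) ⟨ z , w z ⟩)

-- Subsets

_≟ˢ_ : ∀ {m} → DecidableEquality (Subset m)
_≟ˢ_ = ≡-dec BoolP._≟_

∈-allSubsets : ∀ {m} (X : Subset m) → X ∈ allSubsets m
∈-allSubsets Vec.[] = here refl
∈-allSubsets (true Vec.∷ X) = ∈-++⁺ˡ (∈-map⁺ (inside Vec.∷_) (∈-allSubsets X))
∈-allSubsets {suc m} (false Vec.∷ X) =
  ∈-++⁺ʳ (map (inside Vec.∷_) (allSubsets m)) (∈-map⁺ (outside Vec.∷_) (∈-allSubsets X))

allSubsets-unique : ∀ m → Unique (allSubsets m)
allSubsets-unique zero = [] ∷ []
allSubsets-unique (suc m) = Unique.++⁺ (Unique.map⁺ ∷-injectiveʳ (allSubsets-unique m))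
  (Unique.map⁺ ∷-injectiveʳ (allSubsets-unique m)) λ (p , q) → disjoint (∈-map⁻ (inside Vec.∷_) p) (∈-map⁻ (outside Vec.∷_) q)
  where
  disjoint : ∀ {X} → (∃ λ Y → Y ∈ allSubsets m × X ≡ inside Vec.∷ Y) → (∃ λ Y → Y ∈ allSubsets m × X ≡ outside Vec.∷ Y) → False
  disjoint (_ , _ , refl) (_ , _ , ())

⊆-split : ∀ {m} {X Y : Subset m} → X ⊆ Y → X ≡ Y ⊎ X ⊂ Y
⊆-split {X = X} {Y} X⊆Y with X ⊂? Y
... | yes X⊂Y = inj₂ X⊂Y
... | no X⊄Y = inj₁ (⊆-antisym X⊆Y Y⊆X)
  where
  Y⊆X : Y ⊆ X
  Y⊆X {x} x∈Y with x ∈? X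
  ... | yes x∈X = x∈X
  ... | no x∉X = ⊥-elim (X⊄Y (X⊆Y , x , x∈Y , x∉X))

⊂⇒≢⊥ : ∀ {m} {X Y : Subset m} → X ⊂ Y → Y ≢ ⊥
⊂⇒≢⊥ (_ , _ , x∈⊥ , _) refl = ∉⊥ x∈⊥

⊂⇒≢⊤ : ∀ {m} {X Y : Subset m} → X ⊂ Y → X ≢ ⊤
⊂⇒≢⊤ (_ , _ , _ , x∉⊤) refl = x∉⊤ ∈⊤

≢⊥⇒⊥⊂ : ∀ {m} {X : Subset m} → X ≢ ⊥ → ⊥ ⊂ X
≢⊥⇒⊥⊂ {X = X} ne with ⊆-split {Y = X} (λ x∈⊥ → contradiction x∈⊥ ∉⊥)
... | inj₁ e = contradiction (sym e) ne
... | inj₂ s = s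

≢⊤⇒⊂⊤ : ∀ {m} {X : Subset m} → X ≢ ⊤ → X ⊂ ⊤
≢⊤⇒⊂⊤ {X = X} ne with ⊆-split {X = X} (λ _ → ∈⊤)
... | inj₁ e = contradiction e ne
... | inj₂ s = s

∪-lub : ∀ {m} {X Y Z : Subset m} → X ⊆ Z → Y ⊆ Z → X ∪ Y ⊆ Z
∪-lub {X = X} {Y} X⊆Z Y⊆Z x∈ = [ X⊆Z , Y⊆Z ]′ (x∈p∪q⁻ X Y x∈)

⁅⁆-⊆ : ∀ {m} {e : Fin m} {Z : Subset m} → e ∈ˢ Z → ⁅ e ⁆ ⊆ Z
⁅⁆-⊆ {e = e} {Z} e∈Z x∈ = subst (_∈ˢ Z) (sym (x∈⁅y⁆⇒x≡y e x∈)) e∈Z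

-- Chains of subsets

Comparable : ∀ {m} → Subset m → Subset m → Set
Comparable F G = F ⊂ G ⊎ G ⊂ F

Comparable-sym : ∀ {m} {F G : Subset m} → Comparable F G → Comparable G F
Comparable-sym (inj₁ p) = inj₂ p
Comparable-sym (inj₂ p) = inj₁ p

module _ {m : ℕ} where

  sort-insert : ∀ (F : Subset m) cs → All (Comparable F) cs → AllPairs _⊂_ cs →
                ∃ λ cs′ → AllPairs _⊂_ cs′ × (F ∷ cs) ↭ cs′
  sort-insert F [] _ _ = F ∷ [] , [] ∷ [] , ↭-refl
  sort-insert F (c ∷ cs) (inj₁ F⊂c ∷ _) (c⊂cs ∷ s) =
    F ∷ c ∷ cs , (F⊂c ∷ All.map (⊂-trans F⊂c) c⊂cs) ∷ c⊂cs ∷ s , ↭-refl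
  sort-insert F (c ∷ cs) (inj₂ c⊂F ∷ q) (c⊂cs ∷ s) with sort-insert F cs q s
  ... | cs′ , s′ , π = c ∷ cs′ , All-resp-↭ π (c⊂F ∷ c⊂cs) ∷ s′ , ↭-trans (swap F c ↭-refl) (prep c π)

  sort : ∀ {C : List (Subset m)} → AllPairs Comparable C → ∃ λ cs → AllPairs _⊂_ cs × C ↭ cs
  sort [] = [] , [] , ↭-refl
  sort {F ∷ C} (q ∷ qs) with sort qs
  ... | cs , s , π with sort-insert F cs (All-resp-↭ π q) s
  ...   | cs′ , s′ , π′ = cs′ , s′ , ↭-trans (prep F π) π′

  -- These are the cases in every expansion over flats: a term dies because the form vanishes on the
  -- chain, or because the monomial contains an incomparable pair, or else the flat extends the
  -- chain.
  comparable-trichotomy : ∀ (F : Subset m) C →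
    F ∈ C ⊎ (∃ λ c → c ∈ C × ¬ (F ⊆ c) × ¬ (c ⊆ F)) ⊎ All (Comparable F) C
  comparable-trichotomy F [] = inj₂ (inj₂ [])
  comparable-trichotomy F (c ∷ C) with comparable-trichotomy F C
  ... | inj₁ p = inj₁ (there p)
  ... | inj₂ (inj₁ (d , p , q)) = inj₂ (inj₁ (d , there p , q))
  ... | inj₂ (inj₂ a) with F ⊆? c | c ⊆? F
  ...   | yes p | _ with ⊆-split p
  ...     | inj₁ refl = inj₁ (here refl)
  ...     | inj₂ s = inj₂ (inj₂ (inj₁ s ∷ a))
  comparable-trichotomy F (c ∷ C) | inj₂ (inj₂ a) | no ¬p | yes q with ⊆-split q
  ...     | inj₁ refl = inj₁ (here refl)
  ...     | inj₂ s = inj₂ (inj₂ (inj₂ s ∷ a))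
  comparable-trichotomy F (c ∷ C) | inj₂ (inj₂ a) | no ¬p | no ¬q = inj₂ (inj₁ (c , here refl , ¬p , ¬q))

  -- In an increasing list it suffices to avoid the last member below `F`; `D` carries the last one
  -- passed so far.
  separate-below : ∀ (F D : Subset m) cs → D ⊂ F → All (D ⊂_) cs → AllPairs _⊂_ cs → All (Comparable F) cs →
                   ∃ λ i → i ∈ˢ F × i ∉ˢ D × All (λ c → c ⊂ F → i ∉ˢ c) cs
  separate-below F D [] (_ , i , i∈F , i∉D) _ _ _ = i , i∈F , i∉D , []
  separate-below F D (c ∷ cs) (_ , i , i∈F , i∉D) _ (c⊂cs ∷ _) (inj₁ F⊂c ∷ _) =
    i , i∈F , i∉D , (λ c⊂F → contradiction F⊂c (⊂-asymmetric c⊂F))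
      ∷ All.map (λ c⊂c′ c′⊂F → contradiction (⊂-trans F⊂c c⊂c′) (⊂-asymmetric c′⊂F)) c⊂cs
  separate-below F D (c ∷ cs) _ (D⊂c ∷ _) (c⊂cs ∷ s) (inj₂ c⊂F ∷ cmp) with separate-below F c cs c⊂F c⊂cs s cmp
  ... | i , i∈F , i∉c , h = i , i∈F , (λ i∈D → i∉c (proj₁ D⊂c i∈D)) , (λ _ → i∉c) ∷ h

  separate-above : ∀ (F : Subset m) cs → F ⊂ ⊤ → AllPairs _⊂_ cs → All (Comparable F) cs →
                   ∃ λ j → j ∉ˢ F × All (λ c → F ⊂ c → j ∈ˢ c) cs
  separate-above F [] (_ , j , _ , j∉F) _ _ = j , j∉F , []
  separate-above F (c ∷ cs) _ (c⊂cs ∷ _) (inj₁ (_ , j , j∈c , j∉F) ∷ _) =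
    j , j∉F , (λ _ → j∈c) ∷ All.map (λ c⊂c′ _ → proj₁ c⊂c′ j∈c) c⊂cs
  separate-above F (c ∷ cs) F⊂⊤ (_ ∷ s) (inj₂ c⊂F ∷ cmp) with separate-above F cs F⊂⊤ s cmp
  ... | j , j∉F , h = j , j∉F , (λ F⊂c → contradiction c⊂F (⊂-asymmetric F⊂c)) ∷ h

  pairs-lookup : ∀ {C : List (Subset m)} → AllPairs Comparable C → ∀ {a b} → a ∈ C → b ∈ C → a ≡ b ⊎ Comparable a b
  pairs-lookup (_ ∷ _) (here refl) (here refl) = inj₁ refl
  pairs-lookup (q ∷ _) (here refl) (there p) = inj₂ (All.lookup q p)
  pairs-lookup (q ∷ _) (there p) (here refl) = inj₂ (Comparable-sym (All.lookup q p))
  pairs-lookup (_ ∷ qs) (there p) (there p′) = pairs-lookup qs p p′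

-- Flats

module Flats {m : ℕ} (M : Matroid m) (loopless : Loopless M) where

  rk-∪⁅⁆ : ∀ X e → rk M (X ∪ ⁅ e ⁆) ℕ.≤ suc (rk M X)
  rk-∪⁅⁆ X e = begin
    rk M (X ∪ ⁅ e ⁆)                          ≤⟨ ℕP.m≤m+n _ _ ⟩
    rk M (X ∪ ⁅ e ⁆) ℕ.+ rk M (X ∩ ⁅ e ⁆)     ≤⟨ rk-submod M X ⁅ e ⁆ ⟩
    rk M X ℕ.+ rk M ⁅ e ⁆                     ≡⟨ cong (rk M X ℕ.+_) (loopless e) ⟩
    rk M X ℕ.+ 1                              ≡⟨ ℕP.+-comm (rk M X) 1 ⟩
    suc (rk M X) ∎
    where open ℕP.≤-Reasoning

  rk-⊥ : rk M ⊥ ≡ 0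
  rk-⊥ = ℕP.n≤0⇒n≡0 (subst (rk M ⊥ ℕ.≤_) (∣⊥∣≡0 m) (rk-bound M ⊥))

  ⊥-flat : IsFlat M ⊥
  ⊥-flat e _ = subst (ℕ._< rk M (⊥ ∪ ⁅ e ⁆)) (sym rk-⊥)
    (subst (ℕ._≤ rk M (⊥ ∪ ⁅ e ⁆)) (loopless e) (rk-mono M ⁅ e ⁆ (⊥ ∪ ⁅ e ⁆) (q⊆p∪q ⊥ ⁅ e ⁆)))

  flat-⊂-rk : ∀ {F G} → IsFlat M F → F ⊂ G → rk M F ℕ.< rk M G
  flat-⊂-rk {F} {G} fF (F⊆G , e , e∈G , e∉F) =
    ℕP.<-≤-trans (fF e e∉F) (rk-mono M (F ∪ ⁅ e ⁆) G (∪-lub F⊆G (⁅⁆-⊆ e∈G)))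

  flat-⊆-≡ : ∀ {F G} → IsFlat M F → F ⊆ G → rk M G ℕ.≤ rk M F → F ≡ G
  flat-⊆-≡ fF F⊆G le with ⊆-split F⊆G
  ... | inj₁ e = e
  ... | inj₂ s = contradiction (flat-⊂-rk fF s) (ℕP.≤⇒≯ le)

  -- Diminishing returns: by submodularity, adding `e` to a smaller set raises the rank at least as
  -- much as adding it to `F`.
  ∩-rk-< : ∀ F G {e} → IsFlat M F → e ∉ˢ F → rk M (F ∩ G) ℕ.< rk M ((F ∩ G) ∪ ⁅ e ⁆)
  ∩-rk-< F G {e} fF e∉F = ℕP.+-cancelˡ-< (rk M F) _ _ (begin-strict
    rk M F ℕ.+ rk M (F ∩ G)
      <⟨ ℕP.+-monoˡ-< (rk M (F ∩ G)) (fF e e∉F) ⟩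
    rk M (F ∪ ⁅ e ⁆) ℕ.+ rk M (F ∩ G)
      ≤⟨ ℕP.+-mono-≤
           (rk-mono M (F ∪ ⁅ e ⁆) (F ∪ ((F ∩ G) ∪ ⁅ e ⁆)) (∪-lub (p⊆p∪q _) (λ x∈ → q⊆p∪q F _ (q⊆p∪q (F ∩ G) ⁅ e ⁆ x∈))))
           (rk-mono M (F ∩ G) (F ∩ ((F ∩ G) ∪ ⁅ e ⁆)) (λ x∈ → x∈p∩q⁺ (p∩q⊆p F G x∈ , p⊆p∪q ⁅ e ⁆ x∈))) ⟩
    rk M (F ∪ ((F ∩ G) ∪ ⁅ e ⁆)) ℕ.+ rk M (F ∩ ((F ∩ G) ∪ ⁅ e ⁆))
      ≤⟨ rk-submod M F ((F ∩ G) ∪ ⁅ e ⁆) ⟩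
    rk M F ℕ.+ rk M ((F ∩ G) ∪ ⁅ e ⁆) ∎)
    where open ℕP.≤-Reasoning

  ∩-flat : ∀ {F G} → IsFlat M F → IsFlat M G → IsFlat M (F ∩ G)
  ∩-flat {F} {G} fF fG e e∉ with e ∈? F
  ... | no e∉F = ∩-rk-< F G fF e∉F
  ... | yes e∈F = subst (λ X → rk M X ℕ.< rk M (X ∪ ⁅ e ⁆)) (∩-comm G F)
                    (∩-rk-< G F fG (λ e∈G → e∉ (x∈p∩q⁺ (e∈F , e∈G))))

  closure : ∀ X → ∃ λ F → X ⊆ F × IsFlat M F × rk M F ≡ rk M X
  closure X = grow m X (ℕP.m≤n+m m ∣ X ∣)
    where
    -- Elements that do not raise the rank are added one at a time. The fuel `k` bounds the number
    -- of elements still outside `X`, so running out means `X ≡ ⊤`, where flatness is vacuous.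
    grow : ∀ k X → m ℕ.≤ ∣ X ∣ ℕ.+ k → ∃ λ F → X ⊆ F × IsFlat M F × rk M F ≡ rk M X
    grow k X le with isFlat? M X
    ... | yes f = X , (λ x → x) , f , refl
    ... | no ¬f with ¬∀⟶∃¬ m _ (λ e → Dec-e e) ¬f
      where
      Dec-e : ∀ e → Dec (e ∉ˢ X → rk M X ℕ.< rk M (X ∪ ⁅ e ⁆))
      Dec-e e = ¬? (e ∈? X) →-dec (rk M X ℕ.<? rk M (X ∪ ⁅ e ⁆))
    grow zero X le | no ¬f | e , ¬p =
      contradiction (λ e∉X → contradiction (subst (e ∈ˢ_) (sym X≡⊤) ∈⊤) e∉X) ¬p
      where
      X≡⊤ : X ≡ ⊤
      X≡⊤ = ∣p∣≡n⇒p≡⊤ (ℕP.≤-antisym (∣p∣≤n X) (subst (m ℕ.≤_) (ℕP.+-identityʳ ∣ X ∣) le))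
    grow (suc k) X le | no ¬f | e , ¬p with e ∈? X
    ... | yes e∈X = contradiction (λ e∉X → contradiction e∈X e∉X) ¬p
    ... | no e∉X with grow k (X ∪ ⁅ e ⁆) (ℕP.≤-trans le (subst (ℕ._≤ ∣ X ∪ ⁅ e ⁆ ∣ ℕ.+ k) (sym (ℕP.+-suc ∣ X ∣ k))
                        (ℕP.+-monoˡ-≤ k (p⊂q⇒∣p∣<∣q∣ {p = X} (p⊆p∪q ⁅ e ⁆ , e , q⊆p∪q X ⁅ e ⁆ (x∈⁅x⁆ e) , e∉X)))))
    ...   | F , sub , fF , eq = F , (λ x → sub (p⊆p∪q ⁅ e ⁆ x)) , fF
              , trans eq (ℕP.≤-antisym (ℕP.≮⇒≥ (λ lt → ¬p (λ _ → lt))) (rk-mono M X (X ∪ ⁅ e ⁆) (p⊆p∪q ⁅ e ⁆)))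

  -- `G ∩ F` contains `X` and therefore has full rank in `F`; submodularity then leaves no room for
  -- `G ∪ F` to have larger rank than the flat `G`.
  closure-least : ∀ {X F G} → X ⊆ F → rk M F ≡ rk M X → IsFlat M G → X ⊆ G → F ⊆ G
  closure-least {X} {F} {G} X⊆F eq fG X⊆G x∈F =
    subst (_ ∈ˢ_) (sym (flat-⊆-≡ fG (p⊆p∪q F) le)) (q⊆p∪q G F x∈F)
    where
    le : rk M (G ∪ F) ℕ.≤ rk M G
    le = ℕP.+-cancelʳ-≤ (rk M F) _ _ (ℕP.≤-trans
      (ℕP.+-monoʳ-≤ (rk M (G ∪ F)) (subst (ℕ._≤ rk M (G ∩ F)) (sym eq)
         (rk-mono M X (G ∩ F) (λ x → x∈p∩q⁺ (X⊆G x , X⊆F x)))))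
      (rk-submod M G F))

  cover : ∀ {A} e → IsFlat M A → e ∉ˢ A →
    ∃ λ P → A ⊂ P × e ∈ˢ P × IsFlat M P × rk M P ≡ suc (rk M A) × (∀ {G} → IsFlat M G → A ⊆ G → e ∈ˢ G → P ⊆ G)
  cover {A} e fA e∉A with closure (A ∪ ⁅ e ⁆)
  ... | P , sub , fP , eq =
    P , ((λ x → sub (p⊆p∪q ⁅ e ⁆ x)) , e , e∈P , e∉A) , e∈P , fP
      , trans eq (ℕP.≤-antisym (rk-∪⁅⁆ A e) (fA e e∉A))
      , λ fG A⊆G e∈G → closure-least sub eq fG (∪-lub A⊆G (⁅⁆-⊆ e∈G))
    where
    e∈P : e ∈ˢ P
    e∈P = sub (q⊆p∪q A ⁅ e ⁆ (x∈⁅x⁆ e))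

  -- Chains of flats

  -- Unordered, with strict comparability of all pairs, so that a flat is adjoined by consing
  -- wherever it fits; `sort` restores the order for arguments on ranks.
  Chain : List (Subset m) → Set
  Chain C = All (IsPFlat M) C × AllPairs Comparable C

  Good : List (Subset m) → Subset m → Set
  Good C F = IsPFlat M F × All (Comparable F) C

  good? : ∀ C F → Dec (Good C F)
  good? C F = isPFlat? M F ×-dec All.all? (λ c → (F ⊂? c) ⊎-dec (c ⊂? F)) C

  good-chain : ∀ {C F} → Chain C → Good C F → Chain (F ∷ C)
  good-chain (ps , qs) (p , q) = p ∷ ps , q ∷ qs

  extensions : List (Subset m) → List (Subset m)
  extensions C = filter (good? C) (flats M)

  ∈-flats : ∀ {F} → IsPFlat M F → F ∈ flats M
  ∈-flats {F} p = ∈-filter⁺ (isPFlat? M) (∈-allSubsets F) p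

  flats-∈ : ∀ {F} → F ∈ flats M → IsPFlat M F
  flats-∈ p = proj₂ (∈-filter⁻ (isPFlat? M) {xs = allSubsets m} p)

  extensions-unique : ∀ C → Unique (extensions C)
  extensions-unique C = Unique.filter⁺ (good? C) (Unique.filter⁺ (isPFlat? M) (allSubsets-unique m))

  ∈-extensions : ∀ {C F} → Good C F → F ∈ extensions C
  ∈-extensions {C} g = ∈-filter⁺ (good? C) (∈-flats (proj₁ g)) g

  extensions-∈ : ∀ {C F} → F ∈ extensions C → Good C F
  extensions-∈ {C} p = proj₂ (∈-filter⁻ (good? C) {xs = flats M} p)

  chain-length : ∀ A cs → IsFlat M A → A ⊂ ⊤ → All (A ⊂_) cs → All (IsPFlat M) cs → AllPairs _⊂_ cs →
                 length cs ℕ.+ rk M A ℕ.< rk M ⊤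
  chain-length A [] fA A⊂⊤ _ _ _ = flat-⊂-rk fA A⊂⊤
  chain-length A (c ∷ cs) fA _ (A⊂c ∷ _) (((_ , c≢⊤) , fc) ∷ ps) (c⊂cs ∷ s) = begin-strict
    suc (length cs ℕ.+ rk M A)  ≡⟨ sym (ℕP.+-suc (length cs) (rk M A)) ⟩
    length cs ℕ.+ suc (rk M A)  ≤⟨ ℕP.+-monoʳ-≤ (length cs) (flat-⊂-rk fA A⊂c) ⟩
    length cs ℕ.+ rk M c        <⟨ chain-length c cs fc (≢⊤⇒⊂⊤ c≢⊤) c⊂cs ps s ⟩
    rk M ⊤ ∎
    where open ℕP.≤-Reasoning

  -- Each step up the chain raises the rank by at least 1, and the step that jumps over `ρ` raises
  -- it by at least 2.
  missing-rank : ∀ ρ A cs → IsFlat M A → rk M A ℕ.< ρ → ρ ℕ.< rk M ⊤ →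
    All (A ⊂_) cs → All (IsPFlat M) cs → AllPairs _⊂_ cs → All (λ c → rk M c ≢ ρ) cs →
    suc (length cs ℕ.+ rk M A) ℕ.< rk M ⊤
  missing-rank ρ A [] fA A<ρ ρ<⊤ _ _ _ _ = ℕP.≤-<-trans A<ρ ρ<⊤
  missing-rank ρ A (c ∷ cs) fA A<ρ ρ<⊤ (A⊂c ∷ _) (((_ , c≢⊤) , fc) ∷ ps) (c⊂cs ∷ s) (ne ∷ nes) with ℕP.<-cmp (rk M c) ρ
  ... | tri< c<ρ _ _ = ℕP.≤-<-trans (s≤s (subst (ℕ._≤ length cs ℕ.+ rk M c) (ℕP.+-suc (length cs) (rk M A))
                         (ℕP.+-monoʳ-≤ (length cs) (flat-⊂-rk fA A⊂c))))
                       (missing-rank ρ c cs fc c<ρ ρ<⊤ c⊂cs ps s nes)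
  ... | tri≈ _ e _ = contradiction e ne
  ... | tri> _ _ ρ<c = ℕP.≤-<-trans (subst (ℕ._≤ length cs ℕ.+ rk M c)
                         (trans (ℕP.+-suc (length cs) _) (cong suc (ℕP.+-suc (length cs) (rk M A))))
                         (ℕP.+-monoʳ-≤ (length cs) (ℕP.≤-trans (s≤s A<ρ) ρ<c)))
                       (chain-length c cs fc (≢⊤⇒⊂⊤ c≢⊤) c⊂cs ps s)

  -- The length bound forces some consecutive step to raise the rank by at least 2, and a cover `F`
  -- of its lower end `B` fits into it. That `F` covers a member of the chain (or the bottom) is
  -- recorded for the computation in degree two.
  extend-sorted : ∀ A cs → IsFlat M A → All (A ⊂_) cs → All (IsPFlat M) cs → AllPairs _⊂_ cs →
    suc (length cs ℕ.+ rk M A) ℕ.< rk M ⊤ →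
    ∃ λ B → ∃ λ F → (B ≡ A ⊎ B ∈ cs) × A ⊂ F × B ⊂ F × IsPFlat M F × rk M F ≡ suc (rk M B) × All (Comparable F) cs
  extend-sorted A [] fA _ _ _ lt with ≢⊤⇒⊂⊤ {X = A} (λ { refl → ℕP.<-irrefl refl (ℕP.<-trans (ℕP.n<1+n _) lt) })
  ... | (_ , e , _ , e∉A) with cover e fA e∉A
  ...   | P , A⊂P , _ , fP , eq , _ =
    A , P , inj₁ refl , A⊂P , A⊂P , ((⊂⇒≢⊥ A⊂P , λ { refl → ℕP.<-irrefl (sym eq) lt }) , fP) , eq , []
  extend-sorted A (c ∷ cs) fA (A⊂c@(A⊆c , e , e∈c , e∉A) ∷ _) (((_ , c≢⊤) , fc) ∷ ps) (c⊂cs ∷ s) lt with suc (rk M A) ℕP.<? rk M c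
  ... | yes gap with cover e fA e∉A
  ...   | P , A⊂P , _ , fP , eq , least with ⊆-split (least fc A⊆c e∈c)
  ...     | inj₁ refl = contradiction gap (ℕP.<-irrefl (sym eq))
  ...     | inj₂ P⊂c = A , P , inj₁ refl , A⊂P , A⊂P , ((⊂⇒≢⊥ A⊂P , ⊂⇒≢⊤ P⊂c) , fP) , eq
                       , inj₁ P⊂c ∷ All.map (λ q → inj₁ (⊂-trans P⊂c q)) c⊂cs
  extend-sorted A (c ∷ cs) fA (A⊂c ∷ _) (((_ , c≢⊤) , fc) ∷ ps) (c⊂cs ∷ s) lt | no ¬gap
    with extend-sorted c cs fc c⊂cs ps s
           (ℕP.≤-<-trans (s≤s (ℕP.≤-trans (ℕP.+-monoʳ-≤ (length cs) (ℕP.≮⇒≥ ¬gap)) (ℕP.≤-reflexive (ℕP.+-suc (length cs) (rk M A))))) lt)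
  ... | B , F , B∈ , c⊂F , B⊂F , pF , eq , cmp =
    B , F , inj₂ ([ here , there ]′ B∈) , ⊂-trans A⊂c c⊂F , B⊂F , pF , eq , inj₂ c⊂F ∷ cmp

  module Graded (r : ℕ) (rk-⊤ : rk M ⊤ ≡ suc r) where

    rank-bound : ∀ k → k ℕ.< r → suc (k ℕ.+ rk M ⊥) ℕ.< rk M ⊤
    rank-bound k lt rewrite rk-⊥ | rk-⊤ | ℕP.+-identityʳ k = s≤s lt

    extension : ∀ {C} → Chain C → length C ℕ.< r →
      ∃ λ A → ∃ λ F → (A ≡ ⊥ ⊎ A ∈ C) × A ⊂ F × rk M F ≡ suc (rk M A) × Good C F
    extension {C} (ps , qs) lt with sort qs
    ... | cs , s , π with extend-sorted ⊥ cs ⊥-flat (All.map (λ p → ≢⊥⇒⊥⊂ (proj₁ (proj₁ p))) ps′) ps′ s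
                            (rank-bound (length cs) (subst (ℕ._< r) (↭-length π) lt))
      where
      ps′ : All (IsPFlat M) cs
      ps′ = All-resp-↭ π ps
    ...   | A , F , A∈ , _ , A⊂F , pF , eq , cmp =
      A , F , [ inj₁ , (λ p → inj₂ (∈-resp-↭ (↭-sym π) p)) ]′ A∈ , A⊂F , eq , pF , All-resp-↭ (↭-sym π) cmp

    -- The relation with coefficients `ind i - ind j` then vanishes on all of `C` and has
    -- coefficient 1 at `F`.
    separators : ∀ {C F} → Chain C → Good C F →
      ∃ λ i → ∃ λ j → i ∈ˢ F × j ∉ˢ F × (∀ {c} → c ∈ C → c ⊂ F → i ∉ˢ c) × (∀ {c} → c ∈ C → F ⊂ c → j ∈ˢ c)
    separators {C} {F} (ps , qs) (((F≢⊥ , F≢⊤) , _) , cmp) with sort qs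
    ... | cs , s , π with separate-below F ⊥ cs (≢⊥⇒⊥⊂ F≢⊥) (All-resp-↭ π (All.map (λ p → ≢⊥⇒⊥⊂ (proj₁ (proj₁ p))) ps)) s (All-resp-↭ π cmp)
                        | separate-above F cs (≢⊤⇒⊂⊤ F≢⊤) s (All-resp-↭ π cmp)
    ...   | i , i∈F , _ , h | j , j∉F , k =
      i , j , i∈F , j∉F , (λ p → All.lookup h (∈-resp-↭ π p)) , (λ p → All.lookup k (∈-resp-↭ π p))

    maximal-hits : ∀ {C} → Chain C → length C ≡ r → ∀ ρ → 0 ℕ.< ρ → ρ ℕ.≤ r → ¬ All (λ c → rk M c ≢ ρ) C
    maximal-hits {C} (ps , qs) len ρ 0<ρ ρ≤r ne with sort qs
    ... | cs , s , π = ℕP.<-irrefl refl (count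
            (missing-rank ρ ⊥ cs ⊥-flat (subst (ℕ._< ρ) (sym rk-⊥) 0<ρ) (subst (ρ ℕ.<_) (sym rk-⊤) (s≤s ρ≤r))
              (All.map (λ p → ≢⊥⇒⊥⊂ (proj₁ (proj₁ p))) ps′) ps′ s (All-resp-↭ π ne)))
      where
      ps′ : All (IsPFlat M) cs
      ps′ = All-resp-↭ π ps
      count : suc (length cs ℕ.+ rk M ⊥) ℕ.< rk M ⊤ → r ℕ.< r
      count lt rewrite rk-⊥ | rk-⊤ | ℕP.+-identityʳ (length cs) | sym (↭-length π) | len = ℕP.≤-pred lt

    rk-pflat : ∀ {F} → IsPFlat M F → rk M F ℕ.≤ r
    rk-pflat {F} ((_ , ne) , f) = ℕP.≤-pred (subst (rk M F ℕ.<_) rk-⊤ (flat-⊂-rk f (≢⊤⇒⊂⊤ ne)))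

    -- Connectedness of the graph of extensions of a chain

    module _ {C : List (Subset m)} (chain : Chain C) (len : suc (length C) ℕ.< r)
             (u : Subset m → ℚ) (edge : ∀ {F G} → Good C F → Good C G → F ⊂ G → u F ≡ u G) where

      edge-⊆ : ∀ {F G} → Good C F → Good C G → F ⊆ G → u F ≡ u G
      edge-⊆ gF gG s with ⊆-split s
      ... | inj₁ refl = refl
      ... | inj₂ t = edge gF gG t

      in-chain-or-good : ∀ X → IsFlat M X → X ≢ ⊥ → (∀ {c} → c ∈ C → ¬ (X ⊆ c) → ¬ (c ⊆ X) → False) →
                         (X ≡ ⊤ ⊎ X ∈ C) ⊎ Good C X
      in-chain-or-good X fX X≢⊥ cmp with X ≟ˢ ⊤
      ... | yes e = inj₁ (inj₁ e)
      ... | no X≢⊤ with comparable-trichotomy X C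
      ...   | inj₁ p = inj₁ (inj₂ p)
      ...   | inj₂ (inj₁ (c , p , X⊈c , c⊈X)) = ⊥-elim (cmp p X⊈c c⊈X)
      ...   | inj₂ (inj₂ q) = inj₂ (((X≢⊥ , X≢⊤) , fX) , q)

      -- For incomparable `F` and `G` the path goes through `K = F ∩ G` if `K` extends `C`.
      -- Otherwise `K` is a member of `C` or the bottom, and covers `P ⊆ F` and `Q ⊆ G` of `K` are
      -- joined through the closure `J` of their union. If `J` does not extend `C` either, both ends
      -- of an interval of rank 2 are occupied, and the room granted by the length bound must lie
      -- outside that interval.
      extensions-connected : ∀ {F G} → Good C F → Good C G → u F ≡ u G
      extensions-connected {F} {G} gF@(((F≢⊥ , F≢⊤) , fF) , cF) gG@(((G≢⊥ , G≢⊤) , fG) , cG) with F ⊆? G | G ⊆? F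
      ... | yes s | _ = edge-⊆ gF gG s
      ... | no _ | yes s = sym (edge-⊆ gG gF s)
      ... | no F⊈G | no G⊈F with ⊆-split (p∩q⊆p F G) | ⊆-split (p∩q⊆q F G)
      ...   | inj₁ e | _ = ⊥-elim (F⊈G (λ {x} x∈F → p∩q⊆q F G (subst (x ∈ˢ_) (sym e) x∈F)))
      ...   | inj₂ _ | inj₁ e = ⊥-elim (G⊈F (λ {x} x∈G → p∩q⊆p F G (subst (x ∈ˢ_) (sym e) x∈G)))
      ...   | inj₂ K⊂F@(_ , f , f∈F , f∉K) | inj₂ K⊂G@(_ , g , g∈G , g∉K) = go
        where
        K : Subset m
        K = F ∩ G
        fK : IsFlat M K
        fK = ∩-flat fF fG
        -- A member of `C` comparable to both cannot separate the incomparable `F` and `G`, so it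
        -- lies below their meet or above both.
        side : ∀ {Z : Set} {c} → c ∈ C → (c ⊆ K → Z) → (F ⊂ c → G ⊂ c → Z) → Z
        side {Z} {c} p below above with All.lookup cF p | All.lookup cG p
        ... | inj₁ F⊂c | inj₁ G⊂c = above F⊂c G⊂c
        ... | inj₁ F⊂c | inj₂ c⊂G = ⊥-elim (F⊈G (λ x∈ → proj₁ c⊂G (proj₁ F⊂c x∈)))
        ... | inj₂ c⊂F | inj₁ G⊂c = ⊥-elim (G⊈F (λ x∈ → proj₁ c⊂F (proj₁ G⊂c x∈)))
        ... | inj₂ c⊂F | inj₂ c⊂G = below (λ x∈ → x∈p∩q⁺ (proj₁ c⊂F x∈ , proj₁ c⊂G x∈))

        between : ∀ {P} → IsFlat M P → K ⊂ P → (∀ {c} → F ⊂ c → G ⊂ c → P ⊂ c) → P ≢ ⊤ → Good C P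
        between {P} fP K⊂P up ne = ((⊂⇒≢⊥ K⊂P , ne) , fP) , All.tabulate λ p →
          side p (λ c⊆K → inj₂ (⊆-⊂-trans c⊆K K⊂P)) (λ a b → inj₁ (up a b))

        module BottomInC (K∈ : K ≡ ⊥ ⊎ K ∈ C) where
          coverP = cover f fK f∉K
          coverQ = cover g fK g∉K
          P Q : Subset m
          P = proj₁ coverP
          Q = proj₁ coverQ
          K⊂P : K ⊂ P
          K⊂P = proj₁ (proj₂ coverP)
          K⊂Q : K ⊂ Q
          K⊂Q = proj₁ (proj₂ coverQ)
          f∈P : f ∈ˢ P
          f∈P = proj₁ (proj₂ (proj₂ coverP))
          rkP : rk M P ≡ suc (rk M K)
          rkP = proj₁ (proj₂ (proj₂ (proj₂ (proj₂ coverP))))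
          rkQ : rk M Q ≡ suc (rk M K)
          rkQ = proj₁ (proj₂ (proj₂ (proj₂ (proj₂ coverQ))))
          P⊆F : P ⊆ F
          P⊆F = proj₂ (proj₂ (proj₂ (proj₂ (proj₂ coverP)))) fF (p∩q⊆p F G) f∈F
          Q⊆G : Q ⊆ G
          Q⊆G = proj₂ (proj₂ (proj₂ (proj₂ (proj₂ coverQ)))) fG (p∩q⊆q F G) g∈G
          gP : Good C P
          gP = between (proj₁ (proj₂ (proj₂ (proj₂ coverP)))) K⊂P (λ F⊂c _ → ⊆-⊂-trans P⊆F F⊂c)
                 (λ e → F≢⊤ (⊆-antisym (λ _ → ∈⊤) (subst (_⊆ F) e P⊆F)))
          gQ : Good C Q
          gQ = between (proj₁ (proj₂ (proj₂ (proj₂ coverQ)))) K⊂Q (λ _ G⊂c → ⊆-⊂-trans Q⊆G G⊂c)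
                 (λ e → G≢⊤ (⊆-antisym (λ _ → ∈⊤) (subst (_⊆ G) e Q⊆G)))
          join = closure (P ∪ Q)
          J : Subset m
          J = proj₁ join
          P∪Q⊆J : P ∪ Q ⊆ J
          P∪Q⊆J = proj₁ (proj₂ join)
          fJ : IsFlat M J
          fJ = proj₁ (proj₂ (proj₂ join))
          P⊆J : P ⊆ J
          P⊆J x = P∪Q⊆J (p⊆p∪q Q x)
          Q⊆J : Q ⊆ J
          Q⊆J x = P∪Q⊆J (q⊆p∪q P Q x)
          K⊂J : K ⊂ J
          K⊂J = ⊂-⊆-trans K⊂P P⊆J
          rkJ : rk M J ℕ.≤ suc (suc (rk M K))
          rkJ = subst (ℕ._≤ suc (suc (rk M K))) (sym (proj₂ (proj₂ (proj₂ join)))) (ℕP.+-cancelʳ-≤ (rk M K) _ _ (begin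
            rk M (P ∪ Q) ℕ.+ rk M K        ≤⟨ ℕP.+-monoʳ-≤ (rk M (P ∪ Q)) (rk-mono M K (P ∩ Q) (λ x → x∈p∩q⁺ (proj₁ K⊂P x , proj₁ K⊂Q x))) ⟩
            rk M (P ∪ Q) ℕ.+ rk M (P ∩ Q)  ≤⟨ rk-submod M P Q ⟩
            rk M P ℕ.+ rk M Q              ≡⟨ cong₂ ℕ._+_ rkP rkQ ⟩
            suc (rk M K) ℕ.+ suc (rk M K)  ≡⟨ cong suc (ℕP.+-suc (rk M K) (rk M K)) ⟩
            suc (suc (rk M K)) ℕ.+ rk M K ∎))
            where open ℕP.≤-Reasoning
          J⊆c : ∀ {c} → c ∈ C → F ⊂ c → G ⊂ c → J ⊆ c
          J⊆c p F⊂c G⊂c = closure-least P∪Q⊆J (proj₂ (proj₂ (proj₂ join))) (proj₂ (All.lookup (proj₁ chain) p))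
            (∪-lub (λ x → proj₁ F⊂c (P⊆F x)) (λ x → proj₁ G⊂c (Q⊆G x)))

          -- [K , J] has rank 2 and both ends are in the chain, so an extension
          -- of F ∷ C lies outside it, hence is comparable to G as well.
          module TopInC (J∈ : J ≡ ⊤ ⊎ J ∈ C) where
            F⊂J×G⊂J : F ⊂ J × G ⊂ J
            F⊂J×G⊂J = [ (λ e → subst (λ Z → F ⊂ Z × G ⊂ Z) (sym e) (≢⊤⇒⊂⊤ F≢⊤ , ≢⊤⇒⊂⊤ G≢⊤))
                      , (λ p → side p (λ J⊆K → contradiction (J⊆K (P⊆J f∈P)) f∉K) _,_) ]′ J∈
            ext = extension (good-chain chain gF) len
            X : Subset m
            X = proj₁ (proj₂ ext)
            goodX : Good (F ∷ C) X
            goodX = proj₂ (proj₂ (proj₂ (proj₂ (proj₂ ext))))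
            gX : Good C X
            gX = proj₁ goodX , All.tail (proj₂ goodX)
            XF : Comparable X F
            XF = All.head (proj₂ goodX)
            XK : Comparable X K
            XK = [ (λ e → inj₂ (subst (_⊂ X) (sym e) (≢⊥⇒⊥⊂ (proj₁ (proj₁ (proj₁ gX))))))
                 , All.lookup (proj₂ gX) ]′ K∈
            XJ : Comparable X J
            XJ = [ (λ e → inj₁ (subst (X ⊂_) (sym e) (≢⊤⇒⊂⊤ (proj₂ (proj₁ (proj₁ gX))))))
                 , All.lookup (proj₂ gX) ]′ J∈
            uFX : u F ≡ u X
            uFX = [ (λ X⊂F → sym (edge gX gF X⊂F)) , edge gF gX ]′ XF
            no-room : ∀ {A B} → IsFlat M A → IsFlat M B → K ⊂ A → A ⊂ B → B ⊂ J → False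
            no-room fA fB K⊂A A⊂B B⊂J = ℕP.<-irrefl refl (ℕP.<-≤-trans
              (ℕP.≤-<-trans (s≤s (flat-⊂-rk fK K⊂A)) (ℕP.≤-<-trans (flat-⊂-rk fA A⊂B) (flat-⊂-rk fB B⊂J))) rkJ)
            uXG : Comparable X K → Comparable X J → Comparable X F → u X ≡ u G
            uXG (inj₁ X⊂K) _ _ = edge gX gG (⊂-trans X⊂K K⊂G)
            uXG (inj₂ _) (inj₂ J⊂X) _ = sym (edge gG gX (⊂-trans (proj₂ F⊂J×G⊂J) J⊂X))
            uXG (inj₂ K⊂X) (inj₁ X⊂J) (inj₁ X⊂F) = ⊥-elim (no-room (proj₂ (proj₁ gX)) fF K⊂X X⊂F (proj₁ F⊂J×G⊂J))
            uXG (inj₂ K⊂X) (inj₁ X⊂J) (inj₂ F⊂X) = ⊥-elim (no-room fF (proj₂ (proj₁ gX)) K⊂F F⊂X X⊂J)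
            result : u F ≡ u G
            result = trans uFX (uXG XK XJ XF)

          result : u F ≡ u G
          result = [ TopInC.result
                   , (λ gJ → trans (sym (edge-⊆ gP gF P⊆F)) (trans (edge-⊆ gP gJ P⊆J)
                               (trans (sym (edge-⊆ gQ gJ Q⊆J)) (edge-⊆ gQ gG Q⊆G)))) ]′
                   (in-chain-or-good J fJ (⊂⇒≢⊥ K⊂J) (λ p J⊈c c⊈J →
                     side p (λ c⊆K → c⊈J (λ x → proj₁ K⊂J (c⊆K x))) (λ a b → J⊈c (J⊆c p a b))))

        go : u F ≡ u G
        go with K ≟ˢ ⊥
        ... | yes e = BottomInC.result (inj₁ e)
        ... | no K≢⊥ with comparable-trichotomy K C
        ...   | inj₁ p = BottomInC.result (inj₂ p)
        ...   | inj₂ (inj₁ (c , p , K⊈c , c⊈K)) = ⊥-elim (side p c⊈K (λ a _ → K⊈c (λ x → proj₁ a (p∩q⊆p F G x))))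
        ...   | inj₂ (inj₂ cmp) = trans (sym (edge gK gF K⊂F)) (edge gK gG K⊂G)
          where
          gK : Good C K
          gK = ((K≢⊥ , ⊂⇒≢⊤ K⊂F) , fK) , cmp

-- Weights on the ground set and the linear forms they induce

module _ {m : ℕ} where

  ind : Fin m → Subset m → ℚ
  ind i S with i ∈? S
  ... | yes _ = 1ℚ
  ... | no _ = 0ℚ

  ind-∈ : ∀ {i S} → i ∈ˢ S → ind i S ≡ 1ℚ
  ind-∈ {i} {S} p with i ∈? S
  ... | yes _ = refl
  ... | no ¬p = contradiction p ¬p

  ind-∉ : ∀ {i S} → i ∉ˢ S → ind i S ≡ 0ℚ
  ind-∉ {i} {S} ¬p with i ∈? S
  ... | yes p = contradiction p ¬p
  ... | no _ = refl

  ind-nonneg : ∀ i S → 0ℚ ≤ ind i S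
  ind-nonneg i S with i ∈? S
  ... | yes _ = ℚP.nonNegative⁻¹ 1ℚ
  ... | no _ = ℚP.≤-refl

  ind-≤1 : ∀ i S → ind i S ≤ 1ℚ
  ind-≤1 i S with i ∈? S
  ... | yes _ = ℚP.≤-refl
  ... | no _ = ℚP.nonNegative⁻¹ 1ℚ

  ind-∩ : ∀ i X S → ind i X * ind i S ≡ ind i (X ∩ S)
  ind-∩ i X S with i ∈? X | i ∈? S
  ... | yes p | yes q = sym (ind-∈ (x∈p∩q⁺ (p , q)))
  ... | yes p | no ¬q = sym (ind-∉ (λ x → ¬q (p∩q⊆q X S x)))
  ... | no ¬p | yes q = sym (ind-∉ (λ x → ¬p (p∩q⊆p X S x)))
  ... | no ¬p | no ¬q = sym (ind-∉ (λ x → ¬p (p∩q⊆p X S x)))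

  -- The combination of the sums of `x_F` over `F ∋ i` with coefficients `f i`; it is a linear
  -- relation when the total of `f` is 0.
  weight : (Fin m → ℚ) → LinForm m
  weight f S = Σℚ (allFin m) (λ i → ind i S * f i)

  card : Subset m → ℚ
  card X = Σℚ (allFin m) (λ i → ind i X)

  weight-+* : ∀ f c g S → weight (λ i → f i + c * g i) S ≡ weight f S + c * weight g S
  weight-+* f c g S = Coordinates.⟨⟩-+* (allFin m) (λ i → ind i S) f c g

  weight-⊤ : ∀ f → weight f ⊤ ≡ Σℚ (allFin m) f
  weight-⊤ f = Σ-cong (allFin m) (λ {i} _ → trans (cong (_* f i) (ind-∈ {i} ∈⊤)) (ℚP.*-identityˡ (f i)))

  gap : Subset m → Subset m → Fin m → ℚ
  gap A B i = ind i B - ind i A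

  weight-gap : ∀ A B S → weight (gap A B) S ≡ card (B ∩ S) - card (A ∩ S)
  weight-gap A B S = trans (Σ-cong (allFin m) (λ {i} _ → trans
      (solve 3 (λ s b a → s :* (b :- a) := b :* s :- a :* s) refl (ind i S) (ind i B) (ind i A))
      (cong₂ _-_ (ind-∩ i B S) (ind-∩ i A S))))
    (Σ-- (allFin m) _ _)

  ∩-⊆ˡ : ∀ {X S : Subset m} → X ⊆ S → X ∩ S ≡ X
  ∩-⊆ˡ {X} {S} s = ⊆-antisym (p∩q⊆p X S) (λ x → x∈p∩q⁺ (x , s x))

  ∩-⊆ʳ : ∀ {X S : Subset m} → S ⊆ X → X ∩ S ≡ S
  ∩-⊆ʳ {X} {S} s = ⊆-antisym (p∩q⊆q X S) (λ x → x∈p∩q⁺ (s x , x))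

  weight-gap-below : ∀ {A B S} → A ⊆ B → S ⊆ A → weight (gap A B) S ≡ 0ℚ
  weight-gap-below {A} {B} {S} A⊆B S⊆A = trans (weight-gap A B S)
    (trans (cong₂ (λ X Y → card X - card Y) (∩-⊆ʳ {B} {S} (λ x → A⊆B (S⊆A x))) (∩-⊆ʳ {A} {S} S⊆A)) (ℚP.+-inverseʳ (card S)))

  weight-gap-between : ∀ {A B S} → A ⊆ S → S ⊆ B → weight (gap A B) S ≡ card S - card A
  weight-gap-between {A} {B} {S} A⊆S S⊆B = trans (weight-gap A B S)
    (cong₂ (λ X Y → card X - card Y) (∩-⊆ʳ {B} {S} S⊆B) (∩-⊆ˡ {A} {S} A⊆S))

  weight-gap-above : ∀ {A B S} → A ⊆ B → B ⊆ S → weight (gap A B) S ≡ card B - card A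
  weight-gap-above {A} {B} {S} A⊆B B⊆S = trans (weight-gap A B S)
    (cong₂ (λ X Y → card X - card Y) (∩-⊆ˡ {B} {S} B⊆S) (∩-⊆ˡ {A} {S} (λ x → B⊆S (A⊆B x))))

  card-⊂ : ∀ {A B : Subset m} → A ⊂ B → 0ℚ < card B - card A
  card-⊂ {A} {B} (A⊆B , e , e∈B , e∉A) = subst (0ℚ <_) (Σ-- (allFin m) _ _)
    (Σ-pos (allFin m) {λ i → ind i B - ind i A} (λ {i} _ → nonneg i) (∈-allFin e)
      (subst (0ℚ <_) (sym (cong₂ _-_ (ind-∈ e∈B) (ind-∉ e∉A))) (ℚP.positive⁻¹ 1ℚ)))
    where
    nonneg : ∀ i → 0ℚ ≤ ind i B - ind i A
    nonneg i with i ∈? A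
    ... | yes i∈A = ℚP.≤-reflexive (sym (cong (_- 1ℚ) (ind-∈ (A⊆B i∈A))))
    ... | no _ = 0≤-diff (ind-nonneg i B)

  -- The slope of `v` against cardinality from `A` to `S` minus that from `A` to `B`, with
  -- denominators cleared: positive when `v S` lies above the chord.
  concavity : LinForm m → Subset m → Subset m → Subset m → ℚ
  concavity v A S B = (v S - v A) * (card B - card A) - (v B - v A) * (card S - card A)

  concavity-cong : ∀ {v w : LinForm m} → (∀ X → v X ≡ w X) → ∀ A S B → concavity v A S B ≡ concavity w A S B
  concavity-cong {v} {w} h A S B = begin
    (v S - v A) * (card B - card A) - (v B - v A) * (card S - card A)
      ≡⟨ cong (λ t → (v S - t) * (card B - card A) - (v B - t) * (card S - card A)) (h A) ⟩
    (v S - w A) * (card B - card A) - (v B - w A) * (card S - card A)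
      ≡⟨ cong₂ (λ s t → (s - w A) * (card B - card A) - (t - w A) * (card S - card A)) (h S) (h B) ⟩
    (w S - w A) * (card B - card A) - (w B - w A) * (card S - card A) ∎
    where open ≡-Reasoning

  StrictlyConcave : LinForm m → Set
  StrictlyConcave v = ∀ {A S B} → A ⊂ S → S ⊂ B → 0ℚ < concavity v A S B

  -- The weight that interpolates v along A ⊂ c₁ ⊂ ⋯ ⊂ c_k ⊂ ⊤ and is constant on each gap.
  module Interpolation (v : LinForm m) where

    slope : Subset m → Subset m → ℚ
    slope A B = (v B - v A) * recip (card B - card A)

    slope-card : ∀ {A B} → A ⊂ B → slope A B * (card B - card A) ≡ v B - v A
    slope-card {A} {B} s = trans
      (solve 3 (λ v r d → v :* r :* d := v :* (d :* r)) refl (v B - v A) (recip (card B - card A)) (card B - card A))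
      (trans (cong ((v B - v A) *_) (recip-inverse (0<⇒≢0 (card-⊂ s)))) (ℚP.*-identityʳ (v B - v A)))

    interpolant : Subset m → List (Subset m) → Fin m → ℚ
    interpolant A [] i = 0ℚ + slope A ⊤ * gap A ⊤ i
    interpolant A (c ∷ cs) i = interpolant c cs i + slope A c * gap A c i

    weight-step : ∀ f A B S → weight (λ i → f i + slope A B * gap A B i) S ≡ weight f S + slope A B * weight (gap A B) S
    weight-step f A B S = weight-+* f (slope A B) (gap A B) S

    weight-0 : ∀ S → weight (λ _ → 0ℚ) S ≡ 0ℚ
    weight-0 S = Σ-zero (allFin m) (λ {i} _ → ℚP.*-zeroʳ (ind i S))

    interpolant-below : ∀ {A} cs → A ⊂ ⊤ → All (_⊂ ⊤) cs → All (A ⊂_) cs → AllPairs _⊂_ cs →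
                        ∀ {S} → S ⊆ A → weight (interpolant A cs) S ≡ 0ℚ
    interpolant-below {A} [] A⊂⊤ _ _ _ {S} S⊆A = trans (weight-step (λ _ → 0ℚ) A ⊤ S)
      (trans (cong₂ (λ p q → p + slope A ⊤ * q) (weight-0 S) (weight-gap-below {A} {⊤} {S} (λ _ → ∈⊤) S⊆A))
        (trans (ℚP.+-identityˡ _) (ℚP.*-zeroʳ (slope A ⊤))))
    interpolant-below {A} (c ∷ cs) _ (c⊂⊤ ∷ ps) (A⊂c ∷ _) (c⊂cs ∷ s) {S} S⊆A = trans (weight-step (interpolant c cs) A c S)
      (trans (cong₂ (λ p q → p + slope A c * q) (interpolant-below cs c⊂⊤ ps c⊂cs s (λ x → proj₁ A⊂c (S⊆A x)))
          (weight-gap-below {A} {c} {S} (proj₁ A⊂c) S⊆A))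
        (trans (ℚP.+-identityˡ _) (ℚP.*-zeroʳ (slope A c))))

    interpolant-above : ∀ {A c} cs → A ⊂ c → ∀ {S} → c ⊆ S →
      weight (interpolant A (c ∷ cs)) S ≡ weight (interpolant c cs) S + (v c - v A)
    interpolant-above {A} {c} cs A⊂c {S} c⊆S = trans (weight-step (interpolant c cs) A c S)
      (cong (weight (interpolant c cs) S +_)
        (trans (cong (slope A c *_) (weight-gap-above {A} {c} {S} (proj₁ A⊂c) c⊆S)) (slope-card A⊂c)))

    interpolant-⊤ : ∀ {A} cs → A ⊂ ⊤ → All (_⊂ ⊤) cs → All (A ⊂_) cs → AllPairs _⊂_ cs →
                    weight (interpolant A cs) ⊤ ≡ v ⊤ - v A
    interpolant-⊤ {A} [] A⊂⊤ _ _ _ = trans (weight-step (λ _ → 0ℚ) A ⊤ ⊤)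
      (trans (cong₂ _+_ (weight-0 ⊤) (trans (cong (slope A ⊤ *_) (weight-gap-above {A} {⊤} {⊤} (λ _ → ∈⊤) (λ x → x))) (slope-card A⊂⊤)))
        (ℚP.+-identityˡ (v ⊤ - v A)))
    interpolant-⊤ {A} (c ∷ cs) _ (c⊂⊤ ∷ ps) (A⊂c ∷ _) (c⊂cs ∷ s) = trans (interpolant-above cs A⊂c (λ _ → ∈⊤))
      (trans (cong (_+ (v c - v A)) (interpolant-⊤ cs c⊂⊤ ps c⊂cs s))
        (solve 3 (λ t c a → (t :- c) :+ (c :- a) := t :- a) refl (v ⊤) (v c) (v A)))

    interpolant-∈ : ∀ {A} cs → A ⊂ ⊤ → All (_⊂ ⊤) cs → All (A ⊂_) cs → AllPairs _⊂_ cs →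
                    ∀ {c} → c ∈ cs → weight (interpolant A cs) c ≡ v c - v A
    interpolant-∈ {A} (c ∷ cs) _ (c⊂⊤ ∷ ps) (A⊂c ∷ _) (c⊂cs ∷ s) (here refl) = trans (interpolant-above cs A⊂c (λ x → x))
      (trans (cong (_+ (v c - v A)) (interpolant-below cs c⊂⊤ ps c⊂cs s (λ x → x))) (ℚP.+-identityˡ (v c - v A)))
    interpolant-∈ {A} (c ∷ cs) _ (c⊂⊤ ∷ ps) (A⊂c ∷ _) (c⊂cs ∷ s) {d} (there p) =
      trans (interpolant-above cs A⊂c (proj₁ (All.lookup c⊂cs p)))
      (trans (cong (_+ (v c - v A)) (interpolant-∈ cs c⊂⊤ ps c⊂cs s p))
        (solve 3 (λ t c a → (t :- c) :+ (c :- a) := t :- a) refl (v d) (v c) (v A)))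

    module _ (concave : StrictlyConcave v) where

      slope-< : ∀ {A S B} → A ⊂ S → S ⊂ B → slope A B * (card S - card A) < v S - v A
      slope-< {A} {S} {B} A⊂S S⊂B = diff-0< (*-cancel-0< (card-⊂ A⊂B) (subst (0ℚ <_) eq (concave A⊂S S⊂B)))
        where
        A⊂B : A ⊂ B
        A⊂B = ⊂-trans A⊂S S⊂B
        eq : (v S - v A) * (card B - card A) - (v B - v A) * (card S - card A)
             ≡ (card B - card A) * ((v S - v A) - slope A B * (card S - card A))
        eq = trans (cong (λ t → (v S - v A) * (card B - card A) - t * (card S - card A)) (sym (slope-card A⊂B)))
          (solve 4 (λ x d s y → x :* d :- s :* d :* y := d :* (x :- s :* y)) refl
            (v S - v A) (card B - card A) (slope A B) (card S - card A))

      -- Only the gap of the chain that contains `S` matters. There the weight is the chord of `v`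
      -- against cardinality, which strict concavity puts below `v`.
      interpolant-< : ∀ {A} cs → A ⊂ ⊤ → All (_⊂ ⊤) cs → All (A ⊂_) cs → AllPairs _⊂_ cs →
        ∀ {S} → A ⊂ S → S ⊂ ⊤ → All (Comparable S) cs → weight (interpolant A cs) S < v S - v A
      interpolant-< {A} [] A⊂⊤ _ _ _ {S} A⊂S S⊂⊤ _ = subst (_< v S - v A)
        (sym (trans (weight-step (λ _ → 0ℚ) A ⊤ S) (trans (cong₂ (λ p q → p + slope A ⊤ * q) (weight-0 S)
          (weight-gap-between {A} {⊤} {S} (proj₁ A⊂S) (λ _ → ∈⊤))) (ℚP.+-identityˡ _))))
        (slope-< A⊂S S⊂⊤)
      interpolant-< {A} (c ∷ cs) _ (c⊂⊤ ∷ ps) (A⊂c ∷ _) (c⊂cs ∷ s) {S} A⊂S _ (inj₁ S⊂c ∷ _) = subst (_< v S - v A)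
        (sym (trans (weight-step (interpolant c cs) A c S) (trans (cong₂ (λ p q → p + slope A c * q)
          (interpolant-below cs c⊂⊤ ps c⊂cs s (proj₁ S⊂c))
          (weight-gap-between {A} {c} {S} (proj₁ A⊂S) (proj₁ S⊂c))) (ℚP.+-identityˡ _))))
        (slope-< A⊂S S⊂c)
      interpolant-< {A} (c ∷ cs) _ (c⊂⊤ ∷ ps) (A⊂c ∷ _) (c⊂cs ∷ s) {S} A⊂S S⊂⊤ (inj₂ c⊂S ∷ cmp) =
        subst (_< v S - v A) (sym (interpolant-above cs A⊂c (proj₁ c⊂S)))
          (subst (weight (interpolant c cs) S + (v c - v A) <_)
            (solve 3 (λ t c a → (t :- c) :+ (c :- a) := t :- a) refl (v S) (v c) (v A))
            (ℚP.+-monoˡ-< (v c - v A) (interpolant-< cs c⊂⊤ ps c⊂cs s c⊂S S⊂⊤ cmp)))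

-- Linear forms modulo linear relations

module Classes {m : ℕ} (M : Matroid m) (loopless : Loopless M) where

  open Flats M loopless

  infix 4 _∼_
  _∼_ : LinForm m → LinForm m → Set
  v ∼ w = ∃ λ f → Σℚ (allFin m) f ≡ 0ℚ × (∀ {S} → IsPFlat M S → v S ≡ w S + weight f S)

  VanishesOn : List (Subset m) → LinForm m → Set
  VanishesOn C v = ∀ {c} → c ∈ C → v c ≡ 0ℚ

  Ample : LinForm m → Set
  Ample v = ∀ {C} → Chain C → ∃ λ v′ → v ∼ v′ × VanishesOn C v′ × (∀ {F} → Good C F → 0ℚ < v′ F)

  module _ (v : LinForm m) (v-⊥ : v ⊥ ≡ 0ℚ) (v-⊤ : v ⊤ ≡ 0ℚ) (⊥⊂⊤ : ⊥ ⊂ ⊤ {m}) {C : List (Subset m)} (chain : Chain C) where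

    open Interpolation v

    private
      sorted = sort (proj₂ chain)
      cs : List (Subset m)
      cs = proj₁ sorted
      s : AllPairs _⊂_ cs
      s = proj₁ (proj₂ sorted)
      π : C ↭ cs
      π = proj₂ (proj₂ sorted)
      ps : All (IsPFlat M) cs
      ps = All-resp-↭ π (proj₁ chain)
      ⊥⊂cs : All (⊥ ⊂_) cs
      ⊥⊂cs = All.map (λ p → ≢⊥⇒⊥⊂ (proj₁ (proj₁ p))) ps
      cs⊂⊤ : All (_⊂ ⊤) cs
      cs⊂⊤ = All.map (λ p → ≢⊤⇒⊂⊤ (proj₂ (proj₁ p))) ps
      f : Fin m → ℚ
      f = interpolant ⊥ cs

    normalised : LinForm m
    normalised S = v S - weight f S

    normalised-∼ : v ∼ normalised
    normalised-∼ = f , trans (sym (weight-⊤ f)) (trans (interpolant-⊤ cs ⊥⊂⊤ cs⊂⊤ ⊥⊂cs s) (trans (cong₂ _-_ v-⊤ v-⊥) (ℚP.+-inverseʳ 0ℚ)))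
                     , λ {S} _ → solve 2 (λ v w → v := (v :- w) :+ w) refl (v S) (weight f S)

    normalised-vanishes : VanishesOn C normalised
    normalised-vanishes {c} p = trans (cong (λ t → v c - t) (trans (interpolant-∈ cs ⊥⊂⊤ cs⊂⊤ ⊥⊂cs s (∈-resp-↭ π p)) (cong (λ t → v c - t) v-⊥)))
      (solve 1 (λ v → v :- (v :- con 0ℚ) := con 0ℚ) refl (v c))

    normalised-positive : StrictlyConcave v → ∀ {F} → Good C F → 0ℚ < normalised F
    normalised-positive concave {F} (((F≢⊥ , F≢⊤) , _) , cmp) = 0<-diff (subst (weight f F <_) (trans (cong (λ t → v F - t) v-⊥) (solve 1 (λ v → v :- con 0ℚ := v) refl (v F)))
      (interpolant-< concave cs ⊥⊂⊤ cs⊂⊤ ⊥⊂cs s (≢⊥⇒⊥⊂ F≢⊥) (≢⊤⇒⊂⊤ F≢⊤) (All-resp-↭ π cmp)))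

  concave⇒ample : ⊥ ⊂ ⊤ {m} → ∀ v → v ⊥ ≡ 0ℚ → v ⊤ ≡ 0ℚ → StrictlyConcave v → Ample v
  concave⇒ample ne v v-⊥ v-⊤ concave chain =
    normalised v v-⊥ v-⊤ ne chain , normalised-∼ v v-⊥ v-⊤ ne chain
      , normalised-vanishes v v-⊥ v-⊤ ne chain , normalised-positive v v-⊥ v-⊤ ne chain concave

  normalise : ⊥ ⊂ ⊤ {m} → ∀ v {C} → Chain C → ∃ λ v′ → v ∼ v′ × VanishesOn C v′
  normalise ne v chain = normalised v₀ v₀-⊥ v₀-⊤ ne chain
      , (proj₁ n , proj₁ (proj₂ n) , λ {S} p → trans (sym (v₀-flat p)) (proj₂ (proj₂ n) p))
      , normalised-vanishes v₀ v₀-⊥ v₀-⊤ ne chain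
    where
    -- The values at `⊥` and `⊤` do not affect the class, but they must be 0 for the interpolating
    -- weight to have total 0.
    v₀ : LinForm m
    v₀ S with isPFlat? M S
    ... | yes _ = v S
    ... | no _ = 0ℚ
    v₀-flat : ∀ {S} → IsPFlat M S → v₀ S ≡ v S
    v₀-flat {S} p with isPFlat? M S
    ... | yes _ = refl
    ... | no ¬p = contradiction p ¬p
    v₀-⊥ : v₀ ⊥ ≡ 0ℚ
    v₀-⊥ with isPFlat? M ⊥
    ... | yes p = contradiction refl (proj₁ (proj₁ p))
    ... | no _ = refl
    v₀-⊤ : v₀ ⊤ ≡ 0ℚ
    v₀-⊤ with isPFlat? M ⊤
    ... | yes p = contradiction refl (proj₂ (proj₁ p))
    ... | no _ = refl
    n : v₀ ∼ normalised v₀ v₀-⊥ v₀-⊤ ne chain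
    n = normalised-∼ v₀ v₀-⊥ v₀-⊤ ne chain

-- The degree map

module Degree {m : ℕ} (M : Matroid m) (loopless : Loopless M) (r : ℕ) (rk-⊤ : rk M ⊤ ≡ suc r)
  (L : List (Subset m) → ℚ) (isDeg : IsDeg M r L) where

  open Flats M loopless
  open Graded r rk-⊤
  open Classes M loopless
  open IsDeg isDeg

  ⊥⊂⊤ : ⊥ ⊂ ⊤ {m}
  ⊥⊂⊤ = ≢⊤⇒⊂⊤ λ e → ℕP.0≢1+n (trans (sym rk-⊥) (trans (cong (rk M) e) rk-⊤))

  -- The degree of x_{F₁} ⋯ x_{F_k} v₁ ⋯ v_l, where C = F₁, …, F_k.
  deg : List (LinForm m) → List (Subset m) → ℚ
  deg [] C = L C
  deg (v ∷ vs) C = Σℚ (flats M) (λ F → v F * deg vs (F ∷ C))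

  deg-↭ʳ : ∀ vs {C D} → C ↭ D → deg vs C ≡ deg vs D
  deg-↭ʳ [] π = symm _ _ π
  deg-↭ʳ (v ∷ vs) π = Σ-cong (flats M) (λ {F} _ → cong (v F *_) (deg-↭ʳ vs (prep F π)))

  evalProd-deg : ∀ vs (L′ : List (Subset m) → ℚ) C → (∀ mon → L′ mon ≡ L (mon ++ C)) → evalProd M vs L′ ≡ deg vs C
  evalProd-deg [] L′ C h = h []
  evalProd-deg (v ∷ vs) L′ C h = Σ-cong (flats M) λ {F} _ → cong (v F *_)
    (evalProd-deg vs (λ mon → L′ (F ∷ mon)) (F ∷ C) (λ mon → trans (h (F ∷ mon)) (symm _ _ (↭-sym (shift F mon C)))))

  deg-cong-head : ∀ v vs ws C → (∀ D → deg vs D ≡ deg ws D) → deg (v ∷ vs) C ≡ deg (v ∷ ws) C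
  deg-cong-head v vs ws C h = Σ-cong (flats M) (λ {F} _ → cong (v F *_) (h (F ∷ C)))

  deg-swap : ∀ v w vs C → deg (v ∷ w ∷ vs) C ≡ deg (w ∷ v ∷ vs) C
  deg-swap v w vs C = begin
    Σℚ (flats M) (λ F → v F * Σℚ (flats M) (λ G → w G * deg vs (G ∷ F ∷ C)))
      ≡⟨ Σ-cong (flats M) (λ {F} _ → sym (Σ-* (flats M) (v F) _)) ⟩
    Σℚ (flats M) (λ F → Σℚ (flats M) (λ G → v F * (w G * deg vs (G ∷ F ∷ C))))
      ≡⟨ Σ-swap (flats M) (flats M) _ ⟩
    Σℚ (flats M) (λ G → Σℚ (flats M) (λ F → v F * (w G * deg vs (G ∷ F ∷ C))))
      ≡⟨ Σ-cong (flats M) (λ {G} _ → Σ-cong (flats M) (λ {F} _ → trans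
           (cong (λ t → v F * (w G * t)) (deg-↭ʳ vs (swap G F ↭-refl)))
           (solve 3 (λ a b c → a :* (b :* c) := b :* (a :* c)) refl (v F) (w G) (deg vs (F ∷ G ∷ C))))) ⟩
    Σℚ (flats M) (λ G → Σℚ (flats M) (λ F → w G * (v F * deg vs (F ∷ G ∷ C))))
      ≡⟨ Σ-cong (flats M) (λ {G} _ → Σ-* (flats M) (w G) _) ⟩
    Σℚ (flats M) (λ G → w G * Σℚ (flats M) (λ F → v F * deg vs (F ∷ G ∷ C))) ∎
    where open ≡-Reasoning

  deg-↭ : ∀ {vs ws} → vs ↭ ws → ∀ C → deg vs C ≡ deg ws C
  deg-↭ Perm.refl C = refl
  deg-↭ (prep {vs} {ws} v π) C = deg-cong-head v vs ws C (deg-↭ π)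
  deg-↭ (swap {vs} {ws} v w π) C = trans (deg-swap v w vs C)
    (deg-cong-head w (v ∷ vs) (v ∷ ws) C (λ D → deg-cong-head v vs ws D (deg-↭ π)))
  deg-↭ (Perm.trans π ρ) C = trans (deg-↭ π C) (deg-↭ ρ C)

  deg-+* : ∀ v c w vs C → deg ((λ S → v S + c * w S) ∷ vs) C ≡ deg (v ∷ vs) C + c * deg (w ∷ vs) C
  deg-+* v c w vs C = Coordinates.⟨⟩-+*ˡ (flats M) (λ F → deg vs (F ∷ C)) v c w

  Top : List (LinForm m) → List (Subset m) → Set
  Top vs C = length vs ℕ.+ length C ≡ r

  top-step : ∀ v vs F C → Top (v ∷ vs) C → Top vs (F ∷ C)
  top-step _ vs _ C e = trans (ℕP.+-suc (length vs) (length C)) e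

  star : ∀ C i → Σℚ (flats M) (λ F → ind i F * L (F ∷ C)) ≡ Σℚ (filter (i ∈?_) (flats M)) (λ F → L (F ∷ C))
  star C i = trans
    (Σ-filter (i ∈?_) (flats M) (λ {F} _ i∉F → trans (cong (_* L (F ∷ C)) (ind-∉ {i = i} {F} i∉F)) (ℚP.*-zeroˡ (L (F ∷ C)))))
    (Σ-cong (filter (i ∈?_) (flats M)) (λ {F} p → trans
      (cong (_* L (F ∷ C)) (ind-∈ {i = i} {F} (proj₂ (∈-filter⁻ (i ∈?_) {xs = flats M} p)))) (ℚP.*-identityˡ (L (F ∷ C)))))

  star-constant : ∀ C → All (IsPFlat M) C → suc (length C) ≡ r → ∀ i j →
    Σℚ (flats M) (λ F → ind i F * L (F ∷ C)) ≡ Σℚ (flats M) (λ F → ind j F * L (F ∷ C))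
  star-constant C ps len i j = trans (star C i) (trans (linrel i j C ps len) (sym (star C j)))

  -- `linrel` concerns a relation times a monomial, so the relation is moved inward past the other
  -- forms, each expanded into flats, until it is the only form left.
  deg-weight : ∀ f → Σℚ (allFin m) f ≡ 0ℚ → ∀ vs C → All (IsPFlat M) C →
               Top (weight f ∷ vs) C → deg (weight f ∷ vs) C ≡ 0ℚ
  deg-weight f s [] C ps len = begin
    Σℚ (flats M) (λ F → Σℚ (allFin m) (λ i → ind i F * f i) * L (F ∷ C))
      ≡⟨ Σ-cong (flats M) (λ {F} _ → trans (ℚP.*-comm _ (L (F ∷ C))) (sym (Σ-* (allFin m) (L (F ∷ C)) _))) ⟩
    Σℚ (flats M) (λ F → Σℚ (allFin m) (λ i → L (F ∷ C) * (ind i F * f i)))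
      ≡⟨ Σ-swap (flats M) (allFin m) _ ⟩
    Σℚ (allFin m) (λ i → Σℚ (flats M) (λ F → L (F ∷ C) * (ind i F * f i)))
      ≡⟨ Σ-cong (allFin m) (λ {i} _ → trans (Σ-cong (flats M) (λ {F} _ →
           solve 3 (λ l a b → l :* (a :* b) := b :* (a :* l)) refl (L (F ∷ C)) (ind i F) (f i)))
           (trans (Σ-* (flats M) (f i) _) (ℚP.*-comm (f i) _))) ⟩
    Σℚ (allFin m) (λ i → Σℚ (flats M) (λ F → ind i F * L (F ∷ C)) * f i)
      ≡⟨ Σ-const-* (allFin m) _ f (λ {i} {j} _ _ → star-constant C ps len i j) s ⟩
    0ℚ ∎
    where
    open ≡-Reasoning
  deg-weight f s (v ∷ vs) C ps len = trans (deg-swap (weight f) v vs C)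
    (Σ-zero (flats M) (λ {G} p → trans (cong (v G *_)
      (deg-weight f s vs (G ∷ C) (flats-∈ p ∷ ps) (top-step v (weight f ∷ vs) G C len))) (ℚP.*-zeroʳ (v G))))

  deg-∼ : ∀ v w → v ∼ w → ∀ vs C → All (IsPFlat M) C → Top (v ∷ vs) C → deg (v ∷ vs) C ≡ deg (w ∷ vs) C
  deg-∼ v w (f , s , eq) vs C ps len = begin
    deg (v ∷ vs) C
      ≡⟨ Σ-cong (flats M) (λ {F} p → cong (_* deg vs (F ∷ C)) (trans (eq (flats-∈ p)) (cong (w F +_) (sym (ℚP.*-identityˡ (weight f F)))))) ⟩
    deg ((λ S → w S + 1ℚ * weight f S) ∷ vs) C
      ≡⟨ deg-+* w 1ℚ (weight f) vs C ⟩
    deg (w ∷ vs) C + 1ℚ * deg (weight f ∷ vs) C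
      ≡⟨ cong (λ t → deg (w ∷ vs) C + 1ℚ * t) (deg-weight f s vs C ps len) ⟩
    deg (w ∷ vs) C + 1ℚ * 0ℚ
      ≡⟨ solve 1 (λ a → a :+ con 1ℚ :* con 0ℚ := a) refl (deg (w ∷ vs) C) ⟩
    deg (w ∷ vs) C ∎
    where open ≡-Reasoning

  deg-incomparable : ∀ vs {F c C} → c ∈ C → ¬ (F ⊆ c) → ¬ (c ⊆ F) → IsPFlat M F → All (IsPFlat M) C →
                     Top vs (F ∷ C) → deg vs (F ∷ C) ≡ 0ℚ
  deg-incomparable [] {F} {c} {C} p F⊈c c⊈F pF ps len with ∈-∃++ p
  ... | ys , zs , refl = trans (symm _ _ π)
          (incomp F c (ys ++ zs) pF (All.lookup ps p) (All.tail (All-resp-↭ (shift c ys zs) ps)) F⊈c c⊈F (trans (sym (↭-length π)) len))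
    where
    π : F ∷ C ↭ F ∷ c ∷ (ys ++ zs)
    π = prep F (shift c ys zs)
  deg-incomparable (v ∷ vs) {F} {c} {C} p F⊈c c⊈F pF ps len = Σ-zero (flats M) λ {G} q →
    trans (cong (v G *_) (trans (deg-↭ʳ vs (swap G F ↭-refl))
      (deg-incomparable vs (there p) F⊈c c⊈F pF (flats-∈ q ∷ ps) (top-step v vs G (F ∷ C) len)))) (ℚP.*-zeroʳ (v G))

  -- Taking `D` larger than `C` keeps the flats of `D` that extend `C` in the sum. With `D = F ∷ C`
  -- this retains the term at `F` itself, the diagonal entry of the Bochner matrix.
  deg-support : ∀ v vs C D → All (IsPFlat M) D → (∀ {c} → c ∈ C → c ∈ D) → VanishesOn C v → Top (v ∷ vs) D →
                deg (v ∷ vs) D ≡ Σℚ (extensions C) (λ F → v F * deg vs (F ∷ D))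
  deg-support v vs C D ps sub van len = Σ-filter (good? C) (flats M) zero-term
    where
    zero-term : ∀ {F} → F ∈ flats M → ¬ Good C F → v F * deg vs (F ∷ D) ≡ 0ℚ
    zero-term {F} p ¬g = [ (λ q → trans (cong (_* deg vs (F ∷ D)) (van q)) (ℚP.*-zeroˡ (deg vs (F ∷ D))))
      , [ (λ (c , q , F⊈c , c⊈F) → trans (cong (v F *_) (deg-incomparable vs (sub q) F⊈c c⊈F (flats-∈ p) ps (top-step v vs F D len))) (ℚP.*-zeroʳ (v F)))
        , (λ cmp → contradiction (flats-∈ p , cmp) ¬g) ]′ ]′ (comparable-trichotomy F C)

  deg-flag : ∀ {C} → Chain C → length C ≡ r → L C ≡ 1ℚ
  deg-flag (ps , qs) len with sort qs
  ... | cs , s , π = trans (symm _ _ π) (flag cs (All-resp-↭ π ps) (AllPairs⇒Linked s) (trans (sym (↭-length π)) len))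

  room : ∀ (vs : List (LinForm m)) (C : List (Subset m)) → suc (length vs ℕ.+ length C) ≡ r → length C ℕ.< r
  room vs C len = subst (length C ℕ.<_) len (s≤s (ℕP.m≤n+m (length C) (length vs)))

  -- Expanding one ample form in its positive representative gives a nonempty sum of positive
  -- multiples of degrees over longer chains, down to complete flags.
  deg-positive : ∀ vs {C} → Chain C → Top vs C → All Ample vs → 0ℚ < deg vs C
  deg-positive [] chain len [] = subst (0ℚ <_) (sym (deg-flag chain len)) (ℚP.positive⁻¹ 1ℚ)
  deg-positive (v ∷ vs) {C} chain len (av ∷ avs) = subst (0ℚ <_)
      (sym (trans (deg-∼ v v′ v∼ vs C (proj₁ chain) len) (deg-support v′ vs C C (proj₁ chain) (λ p → p) van len)))
      (Σ-pos (extensions C) {λ F → v′ F * deg vs (F ∷ C)} (λ p → ℚP.<⇒≤ (term p)) F∈ (term F∈))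
    where
    v′ : LinForm m
    v′ = proj₁ (av chain)
    v∼ : v ∼ v′
    v∼ = proj₁ (proj₂ (av chain))
    van : VanishesOn C v′
    van = proj₁ (proj₂ (proj₂ (av chain)))
    term : ∀ {F} → F ∈ extensions C → 0ℚ < v′ F * deg vs (F ∷ C)
    term {F} p = 0<* (proj₂ (proj₂ (proj₂ (av chain))) (extensions-∈ p))
      (deg-positive vs (good-chain chain (extensions-∈ p)) (top-step v vs F C len) avs)
    ext = extension chain (room vs C len)
    F∈ : proj₁ (proj₂ ext) ∈ extensions C
    F∈ = ∈-extensions (proj₂ (proj₂ (proj₂ (proj₂ (proj₂ ext)))))

  -- A substitute for having at most one positive eigenvalue. The signs of `ω` ensure that the
  -- hyperplane contains no ample representative, since those are positive on all extensions.
  HyperplaneNegative : List (LinForm m) → List (Subset m) → Set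
  HyperplaneNegative vs C = ∃ λ (ω : Subset m → ℚ) →
    (∀ {F} → Good C F → 0ℚ ≤ ω F) × (∃ λ F → Good C F × 0ℚ < ω F) ×
    (∀ z → VanishesOn C z → Σℚ (extensions C) (λ F → ω F * z F) ≡ 0ℚ → deg (z ∷ z ∷ vs) C ≤ 0ℚ)

  ReverseCauchySchwarz : List (LinForm m) → List (Subset m) → Set
  ReverseCauchySchwarz vs C = ∀ x y → Ample y →
    deg (x ∷ x ∷ vs) C * deg (y ∷ y ∷ vs) C ≤ deg (x ∷ y ∷ vs) C * deg (x ∷ y ∷ vs) C

  deg-∼₂ : ∀ x x′ y y′ → x ∼ x′ → y ∼ y′ → ∀ vs C → All (IsPFlat M) C → Top (x ∷ y ∷ vs) C →
           deg (x ∷ y ∷ vs) C ≡ deg (x′ ∷ y′ ∷ vs) C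
  deg-∼₂ x x′ y y′ x∼ y∼ vs C ps len = begin
    deg (x ∷ y ∷ vs) C    ≡⟨ deg-∼ x x′ x∼ (y ∷ vs) C ps len ⟩
    deg (x′ ∷ y ∷ vs) C   ≡⟨ deg-swap x′ y vs C ⟩
    deg (y ∷ x′ ∷ vs) C   ≡⟨ deg-∼ y y′ y∼ (x′ ∷ vs) C ps len ⟩
    deg (y′ ∷ x′ ∷ vs) C  ≡⟨ deg-swap y′ x′ vs C ⟩
    deg (x′ ∷ y′ ∷ vs) C ∎
    where open ≡-Reasoning

  deg-+*₂ : ∀ x c y vs C → let z = λ S → x S + c * y S in
    deg (z ∷ z ∷ vs) C ≡ deg (x ∷ x ∷ vs) C + c * deg (x ∷ y ∷ vs) C + c * (deg (x ∷ y ∷ vs) C + c * deg (y ∷ y ∷ vs) C)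
  deg-+*₂ x c y vs C = begin
    deg (z ∷ z ∷ vs) C
      ≡⟨ deg-+* x c y (z ∷ vs) C ⟩
    deg (x ∷ z ∷ vs) C + c * deg (y ∷ z ∷ vs) C
      ≡⟨ cong₂ (λ p q → p + c * q) (trans (deg-swap x z vs C) (deg-+* x c y (x ∷ vs) C)) (trans (deg-swap y z vs C) (deg-+* x c y (y ∷ vs) C)) ⟩
    (deg (x ∷ x ∷ vs) C + c * deg (y ∷ x ∷ vs) C) + c * (deg (x ∷ y ∷ vs) C + c * deg (y ∷ y ∷ vs) C)
      ≡⟨ cong (λ t → (deg (x ∷ x ∷ vs) C + c * t) + c * (deg (x ∷ y ∷ vs) C + c * deg (y ∷ y ∷ vs) C)) (deg-swap y x vs C) ⟩
    (deg (x ∷ x ∷ vs) C + c * deg (x ∷ y ∷ vs) C) + c * (deg (x ∷ y ∷ vs) C + c * deg (y ∷ y ∷ vs) C) ∎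
    where
    open ≡-Reasoning
    z : LinForm m
    z S = x S + c * y S

  -- Some combination `z = x′ + c y′` lies in the hyperplane, because `ω` is positive on `y′`.
  -- Nonpositivity of its square is then a statement about a quadratic polynomial in `c` with
  -- positive leading coefficient.
  negative⇒reverse : ∀ vs C → Chain C → suc (suc (length vs ℕ.+ length C)) ≡ r → All Ample vs →
                     HyperplaneNegative vs C → ReverseCauchySchwarz vs C
  negative⇒reverse vs C chain len avs (ω , ω≥0 , (F₀ , gF₀ , ω>0) , neg) x y ay =
    transfer (discriminant c (deg (x′ ∷ x′ ∷ vs) C) (deg (x′ ∷ y′ ∷ vs) C) (deg (y′ ∷ y′ ∷ vs) C)
      (subst (0ℚ <_) (deg-∼₂ y y′ y y′ y∼ y∼ vs C (proj₁ chain) len) (deg-positive (y ∷ y ∷ vs) chain len (ay ∷ ay ∷ avs)))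
      (subst (_≤ 0ℚ) (deg-+*₂ x′ c y′ vs C) (neg z z-van ωz)))
    where
    x-norm = normalise ⊥⊂⊤ x chain
    x′ y′ : LinForm m
    x′ = proj₁ x-norm
    y′ = proj₁ (ay chain)
    x∼ : x ∼ x′
    x∼ = proj₁ (proj₂ x-norm)
    y∼ : y ∼ y′
    y∼ = proj₁ (proj₂ (ay chain))
    open Coordinates (extensions C)
    s t c : ℚ
    s = ⟨ ω , y′ ⟩
    t = ⟨ ω , x′ ⟩
    c = - (t * recip s)
    y>0 : ∀ {F} → Good C F → 0ℚ < y′ F
    y>0 = proj₂ (proj₂ (proj₂ (ay chain)))
    s>0 : 0ℚ < s
    s>0 = Σ-pos (extensions C) {λ F → ω F * y′ F} (λ p → 0≤* (ω≥0 (extensions-∈ p)) (ℚP.<⇒≤ (y>0 (extensions-∈ p))))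
      (∈-extensions gF₀) (0<* ω>0 (y>0 gF₀))
    z : LinForm m
    z S = x′ S + c * y′ S
    z-van : VanishesOn C z
    z-van p = trans (cong₂ (λ a b → a + c * b) (proj₂ (proj₂ x-norm) p) (proj₁ (proj₂ (proj₂ (ay chain))) p))
      (trans (ℚP.+-identityˡ (c * 0ℚ)) (ℚP.*-zeroʳ c))
    ωz : ⟨ ω , z ⟩ ≡ 0ℚ
    ωz = trans (⟨⟩-+* ω x′ c y′) (trans (solve 3 (λ t r s → t :+ (:- (t :* r)) :* s := t :* (con 1ℚ :- s :* r)) refl t (recip s) s)
      (trans (cong (λ u → t * (1ℚ - u)) (recip-inverse (0<⇒≢0 s>0))) (ℚP.*-zeroʳ t)))
    transfer : deg (x′ ∷ x′ ∷ vs) C * deg (y′ ∷ y′ ∷ vs) C ≤ deg (x′ ∷ y′ ∷ vs) C * deg (x′ ∷ y′ ∷ vs) C →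
              deg (x ∷ x ∷ vs) C * deg (y ∷ y ∷ vs) C ≤ deg (x ∷ y ∷ vs) C * deg (x ∷ y ∷ vs) C
    transfer h = subst₂ _≤_ (sym (cong₂ _*_ (deg-∼₂ x x′ x x′ x∼ x∼ vs C (proj₁ chain) len) (deg-∼₂ y y′ y y′ y∼ y∼ vs C (proj₁ chain) len)))
      (sym (cong (λ t → t * t) (deg-∼₂ x x′ y y′ x∼ y∼ vs C (proj₁ chain) len))) h

-- Negativity on a hyperplane

module HodgeRiemann {m : ℕ} (M : Matroid m) (loopless : Loopless M) (r : ℕ) (rk-⊤ : rk M ⊤ ≡ suc r)
  (L : List (Subset m) → ℚ) (isDeg : IsDeg M r L) where

  open Flats M loopless
  open Graded r rk-⊤
  open Classes M loopless
  open Degree M loopless r rk-⊤ L isDeg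

  -- Degree two

  -- Multiply `F ∷ C` by the relation of `separators`. The terms other than the one at `F` are
  -- nonnegative: members of `C` have coefficient 0, incomparable flats have degree 0, and the rest
  -- complete a flag and have a nonnegative coefficient. The term at `F` must balance them.
  self-intersection : ∀ {C F} → Chain C → suc (suc (length C)) ≡ r → Good C F → L (F ∷ F ∷ C) ≤ 0ℚ
  self-intersection {C} {F} chain len gF = ℚP.≮⇒≥ λ 0<FF → 0<⇒≢0
      (Σ-pos (flats M) {term} (λ p → term-nonneg 0<FF p) (∈-flats (proj₁ gF)) (term-F 0<FF)) total
    where
    sep = separators chain gF
    i j : Fin m
    i = proj₁ sep
    j = proj₁ (proj₂ sep)
    i∈F : i ∈ˢ F
    i∈F = proj₁ (proj₂ (proj₂ sep))
    j∉F : j ∉ˢ F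
    j∉F = proj₁ (proj₂ (proj₂ (proj₂ sep)))
    i∉below : ∀ {c} → c ∈ C → c ⊂ F → i ∉ˢ c
    i∉below = proj₁ (proj₂ (proj₂ (proj₂ (proj₂ sep))))
    j∈above : ∀ {c} → c ∈ C → F ⊂ c → j ∈ˢ c
    j∈above = proj₂ (proj₂ (proj₂ (proj₂ (proj₂ sep))))
    ps : All (IsPFlat M) (F ∷ C)
    ps = proj₁ gF ∷ proj₁ chain
    term : Subset m → ℚ
    term G = (ind i G - ind j G) * L (G ∷ F ∷ C)
    total : Σℚ (flats M) term ≡ 0ℚ
    total = trans (Σ-cong (flats M) (λ {G} _ → solve 3 (λ a b l → (a :- b) :* l := a :* l :- b :* l) refl (ind i G) (ind j G) (L (G ∷ F ∷ C))))
      (trans (Σ-- (flats M) _ _) (trans (cong (λ t → t - Σℚ (flats M) (λ G → ind j G * L (G ∷ F ∷ C))) (star-constant (F ∷ C) ps len i j))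
        (ℚP.+-inverseʳ (Σℚ (flats M) (λ G → ind j G * L (G ∷ F ∷ C))))))
    term-F : 0ℚ < L (F ∷ F ∷ C) → 0ℚ < term F
    term-F 0<FF = subst (λ t → 0ℚ < t * L (F ∷ F ∷ C)) (sym (cong₂ _-_ (ind-∈ i∈F) (ind-∉ j∉F)))
      (0<* (ℚP.positive⁻¹ 1ℚ) 0<FF)
    zero-coeff : ∀ {c} → c ∈ C → Comparable F c → ind i c - ind j c ≡ 0ℚ
    zero-coeff p (inj₁ F⊂c) = cong₂ _-_ (ind-∈ (proj₁ F⊂c i∈F)) (ind-∈ (j∈above p F⊂c))
    zero-coeff p (inj₂ c⊂F) = cong₂ _-_ (ind-∉ (i∉below p c⊂F)) (ind-∉ (λ j∈c → j∉F (proj₁ c⊂F j∈c)))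
    nonneg-coeff : ∀ {G} → Comparable G F → 0ℚ ≤ ind i G - ind j G
    nonneg-coeff {G} (inj₁ G⊂F) = subst (λ t → 0ℚ ≤ ind i G - t) (sym (ind-∉ {i = j} {G} (λ j∈G → j∉F (proj₁ G⊂F j∈G))))
      (0≤-diff (ind-nonneg i G))
    nonneg-coeff {G} (inj₂ F⊂G) = subst (λ t → 0ℚ ≤ t - ind j G) (sym (ind-∈ {i = i} {G} (proj₁ F⊂G i∈F))) (0≤-diff (ind-≤1 j G))
    term-nonneg : 0ℚ < L (F ∷ F ∷ C) → ∀ {G} → G ∈ flats M → 0ℚ ≤ term G
    term-nonneg 0<FF {G} p with comparable-trichotomy G (F ∷ C)
    ... | inj₁ (here refl) = ℚP.<⇒≤ (term-F 0<FF)
    ... | inj₁ (there q) = ℚP.≤-reflexive (sym (trans (cong (_* L (G ∷ F ∷ C)) (zero-coeff q (All.lookup (proj₂ gF) q))) (ℚP.*-zeroˡ (L (G ∷ F ∷ C)))))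
    ... | inj₂ (inj₁ (c , q , G⊈c , c⊈G)) = ℚP.≤-reflexive (sym (trans (cong ((ind i G - ind j G) *_)
            (deg-incomparable [] q G⊈c c⊈G (flats-∈ p) ps len)) (ℚP.*-zeroʳ (ind i G - ind j G))))
    ... | inj₂ (inj₂ cmp) = 0≤* (nonneg-coeff (All.head cmp)) (subst (0ℚ ≤_)
            (sym (deg-flag (good-chain (good-chain chain gF) (flats-∈ p , cmp)) len)) (ℚP.nonNegative⁻¹ 1ℚ))

  -- The atoms are the extensions of C whose rank ρ is missing in C.  A form in
  -- the hyperplane can be normalised to vanish on C and on all atoms; the flats
  -- that are left are pairwise incomparable, because a maximal chain hits ρ.
  module MissingRank {C : List (Subset m)} (chain : Chain C) (len : suc (suc (length C)) ≡ r)
    {A F₀ : Subset m} (A∈ : A ≡ ⊥ ⊎ A ∈ C) (rk-F₀ : rk M F₀ ≡ suc (rk M A)) (gF₀ : Good C F₀) where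

    fA : IsFlat M A
    fA = [ (λ e → subst (IsFlat M) (sym e) ⊥-flat) , (λ p → proj₂ (All.lookup (proj₁ chain) p)) ]′ A∈

    ρ : ℕ
    ρ = rk M F₀

    rk-comparable : ∀ {F G} → IsPFlat M F → IsPFlat M G → Comparable F G → rk M F ≢ rk M G
    rk-comparable pF pG (inj₁ F⊂G) e = ℕP.<-irrefl e (flat-⊂-rk (proj₂ pF) F⊂G)
    rk-comparable pF pG (inj₂ G⊂F) e = ℕP.<-irrefl (sym e) (flat-⊂-rk (proj₂ pG) G⊂F)

    ρ-missing : ∀ {c} → c ∈ C → rk M c ≢ ρ
    ρ-missing p = rk-comparable (All.lookup (proj₁ chain) p) (proj₁ gF₀) (Comparable-sym (All.lookup (proj₂ gF₀) p))

    atoms : List (Subset m)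
    atoms = filter (λ X → rk M X ℕ.≟ ρ) (extensions C)

    atoms-good : ∀ {P} → P ∈ atoms → Good C P
    atoms-good p = extensions-∈ (proj₁ (∈-filter⁻ (λ X → rk M X ℕ.≟ ρ) {xs = extensions C} p))

    atoms-rk : ∀ {P} → P ∈ atoms → rk M P ≡ ρ
    atoms-rk p = proj₂ (∈-filter⁻ (λ X → rk M X ℕ.≟ ρ) {xs = extensions C} p)

    A⊂atom : ∀ {P} → P ∈ atoms → A ⊂ P
    A⊂atom {P} p = [ (λ e → subst (_⊂ P) (sym e) (≢⊥⇒⊥⊂ (proj₁ (proj₁ (proj₁ (atoms-good p))))))
      , (λ q → [ (λ P⊂A → contradiction (flat-⊂-rk (proj₂ (proj₁ (atoms-good p))) P⊂A)
                   (ℕP.≤⇒≯ (subst (rk M A ℕ.≤_) (sym (trans (atoms-rk p) rk-F₀)) (ℕP.n≤1+n (rk M A)))))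
               , (λ s → s) ]′ (All.lookup (proj₂ (atoms-good p)) q)) ]′ A∈

    -- Together with `above`: as `ρ = rk A + 1` is missing in `C`, every member of `C` lies inside
    -- `A` or contains all atoms. A weight of total 0 supported on the differences of atoms and `A`
    -- thus vanishes on `C`.
    below : ∀ {c} → c ∈ C → rk M c ℕ.< ρ → c ⊆ A
    below {c} p lt = from A∈
      where
      c≤A : rk M c ℕ.≤ rk M A
      c≤A = ℕP.≤-pred (subst (rk M c ℕ.<_) rk-F₀ lt)
      from : A ≡ ⊥ ⊎ A ∈ C → c ⊆ A
      from (inj₁ refl) = contradiction (flat-⊂-rk ⊥-flat (≢⊥⇒⊥⊂ (proj₁ (proj₁ (All.lookup (proj₁ chain) p))))) (ℕP.≤⇒≯ c≤A)
      from (inj₂ q) with pairs-lookup (proj₂ chain) p q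
      ... | inj₁ refl = λ x → x
      ... | inj₂ (inj₁ c⊂A) = proj₁ c⊂A
      ... | inj₂ (inj₂ A⊂c) = contradiction (flat-⊂-rk fA A⊂c) (ℕP.≤⇒≯ c≤A)

    above : ∀ {c} → c ∈ C → ρ ℕ.< rk M c → ∀ {P} → P ∈ atoms → P ⊆ c
    above {c} p lt {P} q = [ proj₁ , (λ c⊂P → contradiction (flat-⊂-rk (proj₂ (All.lookup (proj₁ chain) p)) c⊂P)
      (ℕP.<-asym (subst (ℕ._< rk M c) (sym (atoms-rk q)) lt))) ]′ (All.lookup (proj₂ (atoms-good q)) p)

    atoms-meet : ∀ {P Q} → P ∈ atoms → Q ∈ atoms → P ≢ Q → P ∩ Q ≡ A
    atoms-meet {P} {Q} p q P≢Q = [ sym , (λ A⊂P∩Q → contradiction (trans (sym (eq p (p∩q⊆p P Q) A⊂P∩Q)) (eq q (p∩q⊆q P Q) A⊂P∩Q)) P≢Q) ]′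
        (⊆-split {X = A} (λ x → x∈p∩q⁺ (proj₁ (A⊂atom p) x , proj₁ (A⊂atom q) x)))
      where
      eq : ∀ {X} → X ∈ atoms → P ∩ Q ⊆ X → A ⊂ P ∩ Q → P ∩ Q ≡ X
      eq x sub A⊂ = flat-⊆-≡ (∩-flat (proj₂ (proj₁ (atoms-good p))) (proj₂ (proj₁ (atoms-good q)))) sub
        (subst (ℕ._≤ rk M (P ∩ Q)) (sym (trans (atoms-rk x) rk-F₀)) (flat-⊂-rk fA A⊂))

    module _ (z : LinForm m) (z-van : VanishesOn C z) (z-sum : Σℚ atoms z ≡ 0ℚ) where

      -- The density that spreads `z P` evenly over `P` minus `A`. These differences are disjoint
      -- for distinct atoms by `atoms-meet`, so the resulting weight takes the value `z P` at each
      -- atom.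
      μ : Subset m → ℚ
      μ P = z P * recip (card P - card A)

      μ-card : ∀ {P} → P ∈ atoms → (card P - card A) * μ P ≡ z P
      μ-card {P} p = trans (solve 3 (λ d z r → d :* (z :* r) := z :* (d :* r)) refl (card P - card A) (z P) (recip (card P - card A)))
        (trans (cong (z P *_) (recip-inverse (0<⇒≢0 (card-⊂ (A⊂atom p))))) (ℚP.*-identityʳ (z P)))

      f : Fin m → ℚ
      f i = Σℚ atoms (λ P → gap A P i * μ P)

      weight-f : ∀ S → weight f S ≡ Σℚ atoms (λ P → weight (gap A P) S * μ P)
      weight-f S = begin
        Σℚ (allFin m) (λ i → ind i S * Σℚ atoms (λ P → gap A P i * μ P))
          ≡⟨ Σ-cong (allFin m) (λ {i} _ → sym (Σ-* atoms (ind i S) _)) ⟩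
        Σℚ (allFin m) (λ i → Σℚ atoms (λ P → ind i S * (gap A P i * μ P)))
          ≡⟨ Σ-swap (allFin m) atoms _ ⟩
        Σℚ atoms (λ P → Σℚ (allFin m) (λ i → ind i S * (gap A P i * μ P)))
          ≡⟨ Σ-cong atoms (λ {P} _ → trans (Σ-cong (allFin m) (λ {i} _ →
               solve 3 (λ a b c → a :* (b :* c) := c :* (a :* b)) refl (ind i S) (gap A P i) (μ P)))
               (trans (Σ-* (allFin m) (μ P) _) (ℚP.*-comm (μ P) (weight (gap A P) S)))) ⟩
        Σℚ atoms (λ P → weight (gap A P) S * μ P) ∎
        where open ≡-Reasoning

      weight-f-below : ∀ {S} → S ⊆ A → weight f S ≡ 0ℚ
      weight-f-below {S} S⊆A = trans (weight-f S) (Σ-zero atoms (λ {P} p →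
        trans (cong (_* μ P) (weight-gap-below {A = A} {P} {S} (proj₁ (A⊂atom p)) S⊆A)) (ℚP.*-zeroˡ (μ P))))

      weight-f-above : ∀ {S} → (∀ {P} → P ∈ atoms → P ⊆ S) → weight f S ≡ 0ℚ
      weight-f-above {S} sub = trans (weight-f S) (trans (Σ-cong atoms (λ {P} p →
        trans (cong (_* μ P) (weight-gap-above {A = A} {P} {S} (proj₁ (A⊂atom p)) (sub p))) (μ-card p))) z-sum)

      weight-f-atom : ∀ {Q} → Q ∈ atoms → weight f Q ≡ z Q
      weight-f-atom {Q} q = trans (weight-f Q) (trans
        (Σ-single {f = λ P → weight (gap A P) Q * μ P} (Unique.filter⁺ (λ X → rk M X ℕ.≟ ρ) (extensions-unique C)) q (λ {P} p ne →
          trans (cong (_* μ P) (trans (weight-gap A P Q) (trans (cong₂ (λ X Y → card X - card Y) (atoms-meet p q ne) (∩-⊆ˡ {X = A} {Q} (proj₁ (A⊂atom q))))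
            (ℚP.+-inverseʳ (card A))))) (ℚP.*-zeroˡ (μ P))))
        (trans (cong (_* μ Q) (weight-gap-between {A = A} {Q} {Q} (proj₁ (A⊂atom q)) (λ x → x))) (μ-card q)))

      z″ : LinForm m
      z″ S = z S - weight f S

      z∼z″ : z ∼ z″
      z∼z″ = f , trans (sym (weight-⊤ f)) (weight-f-above (λ _ _ → ∈⊤))
               , λ {S} _ → solve 2 (λ z w → z := (z :- w) :+ w) refl (z S) (weight f S)

      z″-chain : VanishesOn C z″
      z″-chain {c} p = trans (cong₂ _-_ (z-van p) vanish) (ℚP.+-inverseʳ 0ℚ)
        where
        vanish : weight f c ≡ 0ℚ
        vanish with ℕP.<-cmp (rk M c) ρ
        ... | tri< lt _ _ = weight-f-below (below p lt)
        ... | tri≈ _ e _ = contradiction e (ρ-missing p)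
        ... | tri> _ _ gt = weight-f-above (above p gt)

      z″-atom : ∀ {Q} → Good C Q → rk M Q ≡ ρ → z″ Q ≡ 0ℚ
      z″-atom {Q} g e = trans (cong (λ t → z Q - t) (weight-f-atom (∈-filter⁺ (λ X → rk M X ℕ.≟ ρ) (∈-extensions g) e))) (ℚP.+-inverseʳ (z Q))

      pair-nonpos : ∀ {F G} → Good C F → G ∈ flats M → z″ F * (z″ G * L (G ∷ F ∷ C)) ≤ 0ℚ
      pair-nonpos {F} {G} gF G∈ with comparable-trichotomy G (F ∷ C)
      ... | inj₁ (here refl) = subst (_≤ 0ℚ) (solve 2 (λ z l → (:- (z :* z :* (:- l))) := z :* (z :* l)) refl (z″ F) (L (F ∷ F ∷ C)))
              (ℚP.neg-antimono-≤ (0≤* (0≤sq (z″ F)) (ℚP.neg-antimono-≤ (self-intersection chain len gF))))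
      ... | inj₁ (there q) = ℚP.≤-reflexive (trans (cong (λ t → z″ F * (t * L (G ∷ F ∷ C))) (z″-chain q))
              (solve 2 (λ a l → a :* (con 0ℚ :* l) := con 0ℚ) refl (z″ F) (L (G ∷ F ∷ C))))
      ... | inj₂ (inj₁ (c , q , G⊈c , c⊈G)) = ℚP.≤-reflexive (trans (cong (λ t → z″ F * (z″ G * t))
              (deg-incomparable [] q G⊈c c⊈G (flats-∈ G∈) (proj₁ gF ∷ proj₁ chain) len))
              (solve 2 (λ a b → a :* (b :* con 0ℚ) := con 0ℚ) refl (z″ F) (z″ G)))
      ... | inj₂ (inj₂ cmp) with rk M F ℕ.≟ ρ | rk M G ℕ.≟ ρ
      ...   | yes e | _ = ℚP.≤-reflexive (trans (cong (_* (z″ G * L (G ∷ F ∷ C))) (z″-atom gF e)) (ℚP.*-zeroˡ (z″ G * L (G ∷ F ∷ C))))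
      ...   | no _ | yes e = ℚP.≤-reflexive (trans (cong (λ t → z″ F * (t * L (G ∷ F ∷ C))) (z″-atom (flats-∈ G∈ , All.tail cmp) e))
              (solve 2 (λ a l → a :* (con 0ℚ :* l) := con 0ℚ) refl (z″ F) (L (G ∷ F ∷ C))))
      ...   | no neF | no neG = contradiction (neG ∷ neF ∷ All.tabulate ρ-missing)
              (maximal-hits (good-chain (good-chain chain gF) (flats-∈ G∈ , cmp)) len ρ
                (subst (0 ℕ.<_) (sym rk-F₀) (s≤s z≤n)) (rk-pflat (proj₁ gF₀)))

      square-nonpos : deg (z ∷ z ∷ []) C ≤ 0ℚ
      square-nonpos = subst (_≤ 0ℚ) (sym (trans (deg-∼₂ z z″ z z″ z∼z″ z∼z″ [] C (proj₁ chain) len)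
          (deg-support z″ (z″ ∷ []) C C (proj₁ chain) (λ p → p) z″-chain len)))
        (ℚP.≤-trans (Σ-mono (extensions C) (λ {F} p → ℚP.≤-trans (ℚP.≤-reflexive (sym (Σ-* (flats M) (z″ F) _)))
            (ℚP.≤-trans (Σ-mono (flats M) (pair-nonpos (extensions-∈ p))) (ℚP.≤-reflexive (Σ-zero (flats M) (λ _ → refl))))))
          (ℚP.≤-reflexive (Σ-zero (extensions C) (λ _ → refl))))

    ω : Subset m → ℚ
    ω X with rk M X ℕ.≟ ρ
    ... | yes _ = 1ℚ
    ... | no _ = 0ℚ

    ω-nonneg : ∀ X → 0ℚ ≤ ω X
    ω-nonneg X with rk M X ℕ.≟ ρ
    ... | yes _ = ℚP.nonNegative⁻¹ 1ℚ
    ... | no _ = ℚP.≤-refl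

    ω-atom : ∀ {X} → rk M X ≡ ρ → ω X ≡ 1ℚ
    ω-atom {X} e with rk M X ℕ.≟ ρ
    ... | yes _ = refl
    ... | no ne = contradiction e ne

    ω-other : ∀ {X} → rk M X ≢ ρ → ω X ≡ 0ℚ
    ω-other {X} ne with rk M X ℕ.≟ ρ
    ... | yes e = contradiction e ne
    ... | no _ = refl

    ω-sum : ∀ z → Σℚ (extensions C) (λ F → ω F * z F) ≡ Σℚ atoms z
    ω-sum z = trans (Σ-filter (λ X → rk M X ℕ.≟ ρ) (extensions C) (λ {F} _ ne → trans (cong (_* z F) (ω-other ne)) (ℚP.*-zeroˡ (z F))))
      (Σ-cong atoms (λ {P} p → trans (cong (_* z P) (ω-atom (atoms-rk p))) (ℚP.*-identityˡ (z P))))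

    negative : HyperplaneNegative [] C
    negative = ω , (λ {F} _ → ω-nonneg F) , (F₀ , gF₀ , subst (0ℚ <_) (sym (ω-atom refl)) (ℚP.positive⁻¹ 1ℚ))
      , λ z van s → square-nonpos z van (trans (sym (ω-sum z)) s)

  negative-base : ∀ {C} → Chain C → suc (suc (length C)) ≡ r → HyperplaneNegative [] C
  negative-base {C} chain len = MissingRank.negative chain len (proj₁ e) (proj₁ (proj₂ (proj₂ e))) (proj₂ (proj₂ (proj₂ e)))
    where
    ext = extension chain (subst (length C ℕ.<_) len (s≤s (ℕP.n≤1+n (length C))))
    e = proj₂ (proj₂ ext)

  -- The inductive step

  module BochnerStep (α : LinForm m) (η : List (LinForm m)) {C : List (Subset m)} (chain : Chain C)
    (len : suc (suc (suc (length η ℕ.+ length C))) ≡ r) (ample-α : Ample α) (ample-η : All Ample η)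
    (reverse-link : ∀ {F} → Good C F → ReverseCauchySchwarz η (F ∷ C)) where

    a : LinForm m
    a = proj₁ (ample-α chain)

    α∼a : α ∼ a
    α∼a = proj₁ (proj₂ (ample-α chain))

    a-van : VanishesOn C a
    a-van = proj₁ (proj₂ (proj₂ (ample-α chain)))

    a-pos : ∀ {F} → Good C F → 0ℚ < a F
    a-pos = proj₂ (proj₂ (proj₂ (ample-α chain)))

    N : List (Subset m)
    N = extensions C

    H : Subset m → Subset m → ℚ
    H F G = deg (α ∷ η) (G ∷ F ∷ C)

    -- The matrix of the form in coordinates relative to the representative `a`, in which the class
    -- of `α` is the constant vector 1.
    W : Subset m → Subset m → ℚ
    W F G = a F * a G * H F G

    W-sym : ∀ F G → W F G ≡ W G F
    W-sym F G = cong₂ _*_ (ℚP.*-comm (a F) (a G)) (deg-↭ʳ (α ∷ η) (swap G F ↭-refl))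

    len₁ : suc (suc (length η ℕ.+ suc (length C))) ≡ r
    len₁ = trans (cong (λ k → suc (suc k)) (ℕP.+-suc (length η) (length C))) len

    len₂ : suc (length η ℕ.+ suc (suc (length C))) ≡ r
    len₂ = trans (cong suc (ℕP.+-suc (length η) (suc (length C)))) len₁

    link-chain : ∀ {F} → Good C F → Chain (F ∷ C)
    link-chain = good-chain chain

    H-pos : ∀ {F G} → Good C F → Good C G → Comparable G F → 0ℚ < H F G
    H-pos gF gG cmp = deg-positive (α ∷ η) (good-chain (link-chain gF) (proj₁ gG , cmp ∷ proj₂ gG)) len₂ (ample-α ∷ ample-η)

    H-nonneg : ∀ {F G} → Good C F → Good C G → F ≢ G → 0ℚ ≤ H F G
    H-nonneg {F} {G} gF gG ne with comparable-trichotomy G (F ∷ [])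
    ... | inj₁ (here e) = contradiction (sym e) ne
    ... | inj₂ (inj₁ (c , here refl , G⊈F , F⊈G)) =
          ℚP.≤-reflexive (sym (deg-incomparable (α ∷ η) (here refl) G⊈F F⊈G (proj₁ gG) (proj₁ (link-chain gF)) len₂))
    ... | inj₂ (inj₂ (cmp ∷ [])) = ℚP.<⇒≤ (H-pos gF gG cmp)

    W-nonneg : ∀ {F G} → F ∈ N → G ∈ N → F ≢ G → 0ℚ ≤ W F G
    W-nonneg p q ne = 0≤* (ℚP.<⇒≤ (0<* (a-pos (extensions-∈ p)) (a-pos (extensions-∈ q)))) (H-nonneg (extensions-∈ p) (extensions-∈ q) ne)

    connected : ∀ (u : Subset m → ℚ) → (∀ {F G} → F ∈ N → G ∈ N → F ≢ G → 0ℚ < W F G → u F ≡ u G) →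
                ∀ {F G} → F ∈ N → G ∈ N → u F ≡ u G
    connected u edge p q = extensions-connected chain
      (subst (suc (length C) ℕ.<_) len (s≤s (s≤s (ℕP.m≤n⇒m≤1+n (ℕP.m≤n+m (length C) (length η)))))) u
      (λ gF gG F⊂G → edge (∈-extensions gF) (∈-extensions gG) (λ e → ⊂-irref e F⊂G)
        (0<* (0<* (a-pos gF) (a-pos gG)) (H-pos gF gG (inj₂ F⊂G))))
      (extensions-∈ p) (extensions-∈ q)

    open Coordinates N using (⟨_,_⟩)
    open Laplacian _≟ˢ_ N W W-sym W-nonneg using (w; d; module Connected)
    open Connected connected using (w-nonpos)

    scaled : (Subset m → ℚ) → LinForm m
    scaled x S = a S * x S

    scaled-van : ∀ x → VanishesOn C (scaled x)
    scaled-van x {c} p = trans (cong (_* x c) (a-van p)) (ℚP.*-zeroˡ (x c))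

    w-deg : ∀ x {F} → Good C F → w x F ≡ a F * deg (scaled x ∷ α ∷ η) (F ∷ C)
    w-deg x {F} gF = begin
      Σℚ N (λ G → a F * a G * H F G * x G)
        ≡⟨ Σ-cong N (λ {G} _ → solve 4 (λ a b h x → a :* b :* h :* x := a :* (b :* x :* h)) refl (a F) (a G) (H F G) (x G)) ⟩
      Σℚ N (λ G → a F * (a G * x G * H F G))
        ≡⟨ Σ-* N (a F) _ ⟩
      a F * Σℚ N (λ G → scaled x G * deg (α ∷ η) (G ∷ F ∷ C))
        ≡⟨ cong (a F *_) (sym (deg-support (scaled x) (α ∷ η) C (F ∷ C) (proj₁ (link-chain gF)) there (scaled-van x) len₁)) ⟩
      a F * deg (scaled x ∷ α ∷ η) (F ∷ C) ∎
      where open ≡-Reasoning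

    q : Subset m → ℚ
    q F = deg (α ∷ α ∷ η) (F ∷ C)

    q-pos : ∀ {F} → Good C F → 0ℚ < q F
    q-pos {F} gF = deg-positive (α ∷ α ∷ η) (link-chain gF) len₁ (ample-α ∷ ample-α ∷ ample-η)

    -- The row sum replaces one factor by `a`, which is `α` modulo relations. Hence it is a positive
    -- degree, and the constant vector is fixed by the normalised matrix.
    d-deg : ∀ {F} → Good C F → d F ≡ a F * q F
    d-deg {F} gF = begin
      Σℚ N (λ G → a F * a G * H F G)
        ≡⟨ Σ-cong N (λ {G} _ → ℚP.*-assoc (a F) (a G) (H F G)) ⟩
      Σℚ N (λ G → a F * (a G * H F G))
        ≡⟨ Σ-* N (a F) _ ⟩
      a F * Σℚ N (λ G → a G * deg (α ∷ η) (G ∷ F ∷ C))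
        ≡⟨ cong (a F *_) (sym (deg-support a (α ∷ η) C (F ∷ C) (proj₁ (link-chain gF)) there a-van len₁)) ⟩
      a F * deg (a ∷ α ∷ η) (F ∷ C)
        ≡⟨ cong (a F *_) (sym (deg-∼ α a α∼a (α ∷ η) (F ∷ C) (proj₁ (link-chain gF)) len₁)) ⟩
      a F * q F ∎
      where open ≡-Reasoning

    w-form : ∀ x → ⟨ x , w x ⟩ ≡ deg (scaled x ∷ scaled x ∷ α ∷ η) C
    w-form x = trans (Σ-cong N (λ {F} p → trans (cong (x F *_) (w-deg x (extensions-∈ p)))
        (solve 3 (λ x a t → x :* (a :* t) := a :* x :* t) refl (x F) (a F) (deg (scaled x ∷ α ∷ η) (F ∷ C)))))
      (sym (deg-support (scaled x) (scaled x ∷ α ∷ η) C C (proj₁ chain) (λ p → p) (scaled-van x) len))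

    form-α : ∀ X → deg (X ∷ X ∷ α ∷ η) C ≡ Σℚ N (λ F → a F * deg (X ∷ X ∷ η) (F ∷ C))
    form-α X = begin
      deg (X ∷ X ∷ α ∷ η) C
        ≡⟨ deg-↭ {X ∷ X ∷ α ∷ η} {α ∷ X ∷ X ∷ η} (↭-trans (prep X (swap X α ↭-refl)) (swap X α ↭-refl)) C ⟩
      deg (α ∷ X ∷ X ∷ η) C
        ≡⟨ deg-∼ α a α∼a (X ∷ X ∷ η) C (proj₁ chain) len ⟩
      deg (a ∷ X ∷ X ∷ η) C
        ≡⟨ deg-support a (X ∷ X ∷ η) C C (proj₁ chain) (λ p → p) a-van len ⟩
      Σℚ N (λ F → a F * deg (X ∷ X ∷ η) (F ∷ C)) ∎
      where open ≡-Reasoning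

    -- Writing `α` as the sum of the `a F` times `x_F` distributes the form over the links. On the
    -- link of `F` the hypothesis says that the mixed degree `Xα` equals `q F * y F`, so the reverse
    -- inequality against `α` bounds `XX` by `q F * (y F * y F)`.
    bochner : ∀ (x y : Subset m → ℚ) → (∀ {F} → F ∈ N → w x F ≡ d F * y F) → ⟨ x , w x ⟩ ≤ Σℚ N (λ F → d F * (y F * y F))
    bochner x y h = subst (_≤ Σℚ N (λ F → d F * (y F * y F))) (sym (trans (w-form x) (form-α X)))
        (Σ-mono N (λ {F} p → local (extensions-∈ p) (h p)))
      where
      X : LinForm m
      X = scaled x
      local : ∀ {F} → Good C F → w x F ≡ d F * y F → a F * deg (X ∷ X ∷ η) (F ∷ C) ≤ d F * (y F * y F)
      local {F} gF e = diff-0≤ (subst (0ℚ ≤_) eq (0≤* (ℚP.<⇒≤ (a-pos gF))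
          (*-cancel-0≤ (q-pos gF) (subst (0ℚ ≤_) rearrange (0≤-diff (reverse-link gF X α ample-α))))))
        where
        XX Xα : ℚ
        XX = deg (X ∷ X ∷ η) (F ∷ C)
        Xα = deg (X ∷ α ∷ η) (F ∷ C)
        Xα-value : Xα ≡ q F * y F
        Xα-value = cancel (trans (sym (w-deg x gF)) (trans e (trans (cong (_* y F) (d-deg gF)) (ℚP.*-assoc (a F) (q F) (y F)))))
          where
          cancel : a F * Xα ≡ a F * (q F * y F) → Xα ≡ q F * y F
          cancel k = difference (*-zero-factor (0<⇒≢0 (a-pos gF)) (trans
            (solve 3 (λ a s t → a :* (s :- t) := a :* s :- a :* t) refl (a F) Xα (q F * y F))
            (trans (cong (_- a F * (q F * y F)) k) (ℚP.+-inverseʳ (a F * (q F * y F))))))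
        rearrange : Xα * Xα - XX * q F ≡ q F * (q F * (y F * y F) - XX)
        rearrange = trans (cong (λ t → t * t - XX * q F) Xα-value)
          (solve 3 (λ q y x → q :* y :* (q :* y) :- x :* q := q :* (q :* (y :* y) :- x)) refl (q F) (y F) XX)
        eq : a F * (q F * (y F * y F) - XX) ≡ d F * (y F * y F) - a F * XX
        eq = trans (solve 4 (λ a q s x → a :* (q :* s :- x) := a :* q :* s :- a :* x) refl (a F) (q F) (y F * y F) XX)
          (cong (λ t → t * (y F * y F) - a F * XX) (sym (d-deg gF)))

    square-nonpos : ∀ z → VanishesOn C z → Σℚ N (λ F → q F * z F) ≡ 0ℚ → deg (z ∷ z ∷ α ∷ η) C ≤ 0ℚ
    square-nonpos z van s = subst (_≤ 0ℚ) (trans (w-form ζ) agree₂) (w-nonpos bochner ζ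
        (trans (Σ-cong N (λ {F} p → trans (cong (_* ζ F) (d-deg (extensions-∈ p)))
          (trans (solve 3 (λ a q z → a :* q :* z := q :* (a :* z)) refl (a F) (q F) (ζ F)) (cong (q F *_) (Z-z (extensions-∈ p)))))) s))
      where
      -- The coordinates of `z` relative to `a`. Since `d F * ζ F` equals `q F * z F` on extensions,
      -- the hyperplane of `q` is the `d`-orthogonal complement of the constants.
      ζ : Subset m → ℚ
      ζ F = z F * recip (a F)
      Z : LinForm m
      Z = scaled ζ
      Z-z : ∀ {F} → Good C F → Z F ≡ z F
      Z-z {F} gF = trans (solve 3 (λ a z r → a :* (z :* r) := z :* (a :* r)) refl (a F) (z F) (recip (a F)))
        (trans (cong (z F *_) (recip-inverse (0<⇒≢0 (a-pos gF)))) (ℚP.*-identityʳ (z F)))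
      -- `Z` and `z` may differ elsewhere, but both vanish on `C` and they agree on its extensions,
      -- which are all that the degree sees.
      agree : ∀ x → deg (Z ∷ x ∷ α ∷ η) C ≡ deg (z ∷ x ∷ α ∷ η) C
      agree x = trans (deg-support Z (x ∷ α ∷ η) C C (proj₁ chain) (λ p → p) (scaled-van ζ) len)
        (trans (Σ-cong N (λ {F} p → cong (_* deg (x ∷ α ∷ η) (F ∷ C)) (Z-z (extensions-∈ p))))
          (sym (deg-support z (x ∷ α ∷ η) C C (proj₁ chain) (λ p → p) van len)))
      agree₂ : deg (Z ∷ Z ∷ α ∷ η) C ≡ deg (z ∷ z ∷ α ∷ η) C
      agree₂ = trans (agree Z) (trans (deg-swap z Z (α ∷ η) C) (agree z))

    negative : HyperplaneNegative (α ∷ η) C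
    negative = q , (λ gF → ℚP.<⇒≤ (q-pos gF)) , (F₀ , gF₀ , q-pos gF₀) , square-nonpos
      where
      ext = extension chain (room (α ∷ α ∷ η) C len)
      F₀ : Subset m
      F₀ = proj₁ (proj₂ ext)
      gF₀ : Good C F₀
      gF₀ = proj₂ (proj₂ (proj₂ (proj₂ (proj₂ ext))))

  -- The statement covers all chains because passing to a link trades one ample form for one more
  -- flat in the chain, at constant total degree.
  reverse-Cauchy–Schwarz : ∀ vs C → Chain C → suc (suc (length vs ℕ.+ length C)) ≡ r → All Ample vs → ReverseCauchySchwarz vs C
  reverse-Cauchy–Schwarz [] C chain len [] = negative⇒reverse [] C chain len [] (negative-base chain len)
  reverse-Cauchy–Schwarz (α ∷ η) C chain len (aα ∷ aη) = negative⇒reverse (α ∷ η) C chain len (aα ∷ aη)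
    (BochnerStep.negative α η chain len aα aη (λ {F} gF → reverse-Cauchy–Schwarz η (F ∷ C) (good-chain chain gF)
      (trans (cong (λ k → suc (suc k)) (ℕP.+-suc (length η) (length C))) len) aη))

-- Rational cardinalities

ι : ℕ → ℚ
ι k = pos k / 1

/-homo-* : ∀ k s n → (pos (k ℕ.* s)) / suc n ≡ (pos k / suc n) * ι s
/-homo-* k s n = ℚP.toℚᵘ-injective (ℚᵘP.≃-trans (ℚP.toℚᵘ-fromℚᵘ (mkℚᵘ (pos (k ℕ.* s)) n))
  (ℚᵘP.≃-trans (*≡* eq) (ℚᵘP.≃-sym (ℚᵘP.≃-trans (ℚP.toℚᵘ-homo-* (pos k / suc n) (ι s))
    (ℚᵘP.*-cong (ℚP.toℚᵘ-fromℚᵘ (mkℚᵘ (pos k) n)) (ℚP.toℚᵘ-fromℚᵘ (mkℚᵘ (pos s) 0)))))))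
  where
  eq : pos (k ℕ.* s) ℤ.* pos (suc n ℕ.* 1) ≡ (pos k ℤ.* pos s) ℤ.* pos (suc n)
  eq = cong₂ (λ a b → a ℤ.* pos b) (ℤP.pos-* k s) (ℕP.*-identityʳ (suc n))

ι-suc : ∀ k → ι (suc k) ≡ 1ℚ + ι k
ι-suc k = ℚP.toℚᵘ-injective (ℚᵘP.≃-trans (ℚP.toℚᵘ-fromℚᵘ (mkℚᵘ (pos (suc k)) 0))
  (ℚᵘP.≃-trans (*≡* eq) (ℚᵘP.≃-sym (ℚᵘP.≃-trans (ℚP.toℚᵘ-homo-+ 1ℚ (ι k))
    (ℚᵘP.+-congʳ ℚᵘ.1ℚᵘ (ℚP.toℚᵘ-fromℚᵘ (mkℚᵘ (pos k) 0)))))))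
  where
  eq : pos (suc k) ℤ.* pos 1 ≡ (pos 1 ℤ.* pos 1 ℤ.+ pos k ℤ.* pos 1) ℤ.* pos 1
  eq = cong (ℤ._* pos 1) (cong (λ t → pos 1 ℤ.+ t) (sym (ℤP.*-identityʳ (pos k))))

/-cancel : ∀ k n → (pos (k ℕ.* suc n)) / suc n ≡ ι k
/-cancel k n = ℚP.fromℚᵘ-cong {mkℚᵘ (pos (k ℕ.* suc n)) n} {mkℚᵘ (pos k) 0}
  (*≡* (trans (ℤP.*-identityʳ (pos (k ℕ.* suc n))) (ℤP.pos-* k (suc n))))

ι-mono : ∀ {a b} → a ℕ.≤ b → ι a ≤ ι b
ι-mono {b = zero} z≤n = ℚP.≤-refl
ι-mono {b = suc b} z≤n = subst (0ℚ ≤_) (sym (ι-suc b)) (0≤+ (ℚP.nonNegative⁻¹ 1ℚ) (ι-mono {0} {b} z≤n))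
ι-mono {suc a} {suc b} (s≤s p) = subst₂ _≤_ (sym (ι-suc a)) (sym (ι-suc b)) (ℚP.+-monoʳ-≤ 1ℚ (ι-mono p))

ind-suc : ∀ {m} (i : Fin m) s X → ind (fsuc i) (s Vec.∷ X) ≡ ind i X
ind-suc i s X = by (i ∈? X)
  where
  by : Dec (i ∈ˢ X) → ind (fsuc i) (s Vec.∷ X) ≡ ind i X
  by (yes p) = trans (ind-∈ (Vec.there p)) (sym (ind-∈ p))
  by (no ¬p) = trans (ind-∉ {i = fsuc i} {s Vec.∷ X} (λ q → ¬p (drop-there q))) (sym (ind-∉ ¬p))

Σ-map : ∀ {A B : Set} (g : A → B) (xs : List A) (f : B → ℚ) → Σℚ (map g xs) f ≡ Σℚ xs (λ x → f (g x))
Σ-map g [] f = refl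
Σ-map g (x ∷ xs) f = cong (f (g x) +_) (Σ-map g xs f)

card-suc : ∀ {m} s (X : Subset m) → card (s Vec.∷ X) ≡ ind fzero (s Vec.∷ X) + card X
card-suc {m} s X = cong (ind fzero (s Vec.∷ X) +_)
  (trans (cong (λ xs → Σℚ xs (λ i → ind i (s Vec.∷ X))) (sym (map-tabulate (λ i → i) fsuc)))
    (trans (Σ-map fsuc (allFin m) _) (Σ-cong (allFin m) (λ {i} _ → ind-suc i s X))))

card-ι : ∀ {m} (X : Subset m) → card X ≡ ι ∣ X ∣
card-ι Vec.[] = refl
card-ι (true Vec.∷ X) = trans (card-suc true X) (trans (cong₂ _+_ (ind-∈ {i = fzero} {true Vec.∷ X} Vec.here) (card-ι X)) (sym (ι-suc ∣ X ∣)))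
card-ι (false Vec.∷ X) = trans (card-suc false X) (trans (cong₂ _+_ (ind-∉ {i = fzero} {false Vec.∷ X} (λ ())) (card-ι X)) (ℚP.+-identityˡ (ι ∣ X ∣)))

-- Hypersimplex classes

module Hypersimplex (n : ℕ) where

  size : ℚ
  size = card {suc n} ⊤

  parabola : LinForm (suc n)
  parabola S = card S * (size - card S)

  module _ (k : ℕ) (k≤n : k ℕ.≤ suc n) where

    κ : ℚ
    κ = pos k / suc n

    cap : LinForm (suc n)
    cap S = ι (∣ S ∣ ℕ.⊓ k)

    γ-cap : ∀ S → γ n k S ≡ cap S - κ * card S
    γ-cap S = cong (λ t → cap S - t) (trans (/-homo-* k ∣ S ∣ n) (cong (κ *_) (sym (card-ι S))))

    card-⊥ : card {suc n} ⊥ ≡ 0ℚ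
    card-⊥ = Σ-zero (allFin (suc n)) (λ {i} _ → ind-∉ {i = i} {⊥} ∉⊥)

    γ-⊥ : γ n k ⊥ ≡ 0ℚ
    γ-⊥ = trans (γ-cap ⊥) (cong₂ (λ a b → ι (a ℕ.⊓ k) - b) (∣⊥∣≡0 (suc n)) (trans (cong (κ *_) card-⊥) (ℚP.*-zeroʳ κ)))

    γ-⊤ : γ n k ⊤ ≡ 0ℚ
    γ-⊤ = trans (cong₂ _-_ (cong ι (trans (cong (ℕ._⊓ k) (∣⊤∣≡n (suc n))) (ℕP.m≥n⇒m⊓n≡n k≤n)))
        (trans (cong (λ t → pos (k ℕ.* t) / suc n) (∣⊤∣≡n (suc n))) (/-cancel k n)))
      (ℚP.+-inverseʳ (ι k))

    cap-≤-card : ∀ S → 0ℚ ≤ card S - cap S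
    cap-≤-card S = 0≤-diff (subst (cap S ≤_) (sym (card-ι S)) (ι-mono (ℕP.m⊓n≤m ∣ S ∣ k)))

    cap-≤-k : ∀ S → 0ℚ ≤ ι k - cap S
    cap-≤-k S = 0≤-diff (ι-mono (ℕP.m⊓n≤n ∣ S ∣ k))

    -- `cap` lies below both the cardinality and the constant `k`, and at `S` it touches one of
    -- these two affine functions of cardinality; hence the two cases.
    cap-concave : ∀ {A S B} → A ⊂ S → S ⊂ B →
      0ℚ ≤ concavity cap A S B
    cap-concave {A} {S} {B} A⊂S S⊂B = [ small , large ]′ (ℕP.≤-total ∣ S ∣ k)
      where
      AS : 0ℚ ≤ card S - card A
      AS = ℚP.<⇒≤ (card-⊂ A⊂S)
      SB : 0ℚ ≤ card B - card S
      SB = ℚP.<⇒≤ (card-⊂ S⊂B)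
      small : ∣ S ∣ ℕ.≤ k → 0ℚ ≤ concavity cap A S B
      small le = subst (λ t → 0ℚ ≤ (t - cap A) * (card B - card A) - (cap B - cap A) * (card S - card A))
        (sym (trans (cong ι (ℕP.m≤n⇒m⊓n≡m le)) (sym (card-ι S))))
        (subst (0ℚ ≤_) (solve 5 (λ a s b f g → (a :- f) :* (b :- s) :+ (b :- g) :* (s :- a)
            := (s :- f) :* (b :- a) :- (g :- f) :* (s :- a)) refl (card A) (card S) (card B) (cap A) (cap B))
          (0≤+ (0≤* (cap-≤-card A) SB) (0≤* (cap-≤-card B) AS)))
      large : k ℕ.≤ ∣ S ∣ → 0ℚ ≤ concavity cap A S B
      large le = subst (λ t → 0ℚ ≤ (t - cap A) * (card B - card A) - (cap B - cap A) * (card S - card A))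
        (sym (cong ι (ℕP.m≥n⇒m⊓n≡n le)))
        (subst (0ℚ ≤_) (solve 6 (λ a s b f g K → (K :- f) :* (b :- s) :+ (K :- g) :* (s :- a)
            := (K :- f) :* (b :- a) :- (g :- f) :* (s :- a)) refl (card A) (card S) (card B) (cap A) (cap B) (ι k))
          (0≤+ (0≤* (cap-≤-k A) SB) (0≤* (cap-≤-k B) AS)))

    perturbed : ℚ → LinForm (suc n)
    perturbed ε S = γ n k S + ε * parabola S

    perturbed-⊥ : ∀ ε → perturbed ε ⊥ ≡ 0ℚ
    perturbed-⊥ ε = trans (cong₂ (λ a b → a + ε * (b * (size - b))) γ-⊥ card-⊥)
      (solve 2 (λ e t → con 0ℚ :+ e :* (con 0ℚ :* (t :- con 0ℚ)) := con 0ℚ) refl ε size)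

    perturbed-⊤ : ∀ ε → perturbed ε ⊤ ≡ 0ℚ
    perturbed-⊤ ε = trans (cong (_+ ε * parabola ⊤) γ-⊤)
      (solve 2 (λ e t → con 0ℚ :+ e :* (t :* (t :- t)) := con 0ℚ) refl ε size)

    -- The term linear in cardinality drops out of `concavity`, and the parabola contributes exactly
    -- ε (b - a)(s - a)(b - s), where a, s, b are the three cardinalities.
    perturbed-concave : ∀ ε → 0ℚ < ε → StrictlyConcave (perturbed ε)
    perturbed-concave ε 0<ε {A} {S} {B} A⊂S S⊂B = subst (0ℚ <_)
      (trans (solve 9 (λ e c a s b t f g h →
          e :* ((b :- a) :* ((s :- a) :* (b :- s))) :+ ((g :- f) :* (b :- a) :- (h :- f) :* (s :- a))
          := ((g :- c :* s :+ e :* (s :* (t :- s))) :- (f :- c :* a :+ e :* (a :* (t :- a)))) :* (b :- a)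
             :- ((h :- c :* b :+ e :* (b :* (t :- b))) :- (f :- c :* a :+ e :* (a :* (t :- a)))) :* (s :- a)) refl
          ε κ (card A) (card S) (card B) size (cap A) (cap S) (cap B))
        (concavity-cong {v = λ X → cap X - κ * card X + ε * (card X * (size - card X))} {perturbed ε}
          (λ X → cong (_+ ε * parabola X) (sym (γ-cap X))) A S B))
      (0<+ (0<* 0<ε (0<* (card-⊂ (⊂-trans A⊂S S⊂B)) (0<* (card-⊂ A⊂S) (card-⊂ S⊂B)))) (cap-concave A⊂S S⊂B))

-- From ample to nef classes

product-limit : ∀ a a′ b b′ c c′ → (∀ ε → 0ℚ < ε → (a + ε * a′) * (b + ε * b′) ≤ (c + ε * c′) * (c + ε * c′)) → a * b ≤ c * c
product-limit a a′ b b′ c c′ h = diff-0≤ (0≤-limit (c * c - a * b) (c * c′ + c * c′ - (a * b′ + a′ * b)) (c′ * c′ - a′ * b′)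
  λ ε 0<ε → subst (0ℚ ≤_) (solve 7 (λ a a′ b b′ c c′ e →
      (c :+ e :* c′) :* (c :+ e :* c′) :- (a :+ e :* a′) :* (b :+ e :* b′)
      := (c :* c :- a :* b) :+ e :* (c :* c′ :+ c :* c′ :- (a :* b′ :+ a′ :* b)) :+ e :* e :* (c′ :* c′ :- a′ :* b′)) refl a a′ b b′ c c′ ε)
    (0≤-diff (h ε 0<ε)))

square-limit : ∀ a b b′ b″ c c′ → (∀ ε → 0ℚ < ε → a * (b + ε * b′ + ε * (b′ + ε * b″)) ≤ (c + ε * c′) * (c + ε * c′)) → a * b ≤ c * c
square-limit a b b′ b″ c c′ h = diff-0≤ (0≤-limit (c * c - a * b) (c * c′ + c * c′ - (a * b′ + a * b′)) (c′ * c′ - a * b″)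
  λ ε 0<ε → subst (0ℚ ≤_) (solve 7 (λ a b b′ b″ c c′ e →
      (c :+ e :* c′) :* (c :+ e :* c′) :- a :* (b :+ e :* b′ :+ e :* (b′ :+ e :* b″))
      := (c :* c :- a :* b) :+ e :* (c :* c′ :+ c :* c′ :- (a :* b′ :+ a :* b′)) :+ e :* e :* (c′ :* c′ :- a :* b″)) refl a b b′ b″ c c′ ε)
    (0≤-diff (h ε 0<ε)))

module NefLimit {m : ℕ} (M : Matroid m) (loopless : Loopless M) (r : ℕ) (rk-⊤ : rk M ⊤ ≡ suc r)
  (L : List (Subset m) → ℚ) (isDeg : IsDeg M r L) (q : LinForm m) where

  open Classes M loopless
  open Degree M loopless r rk-⊤ L isDeg
  open HodgeRiemann M loopless r rk-⊤ L isDeg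

  Nef : LinForm m → Set
  Nef v = ∀ ε → 0ℚ < ε → Ample (λ S → v S + ε * q S)

  -- The nef factors are made ample one at a time, so that each degree is affine in ε and the
  -- inequality is quadratic, as `0≤-limit` requires. The argument `y` occurs twice in one degree
  -- and is perturbed last, with `x` left unchanged, which again gives a quadratic.
  reverse-nef : ∀ us ws → All Nef us → All Ample ws → suc (suc (length (us ++ ws) ℕ.+ 0)) ≡ r → ∀ x y → Nef y →
    deg (x ∷ x ∷ us ++ ws) [] * deg (y ∷ y ∷ us ++ ws) [] ≤ deg (x ∷ y ∷ us ++ ws) [] * deg (x ∷ y ∷ us ++ ws) []
  reverse-nef [] ws [] aws len x y ny =
    square-limit (deg (x ∷ x ∷ ws) []) (deg (y ∷ y ∷ ws) []) (deg (y ∷ q ∷ ws) []) (deg (q ∷ q ∷ ws) []) (deg (x ∷ y ∷ ws) []) (deg (x ∷ q ∷ ws) [])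
      λ ε 0<ε → subst₂ _≤_ (cong (deg (x ∷ x ∷ ws) [] *_) (deg-+*₂ y ε q ws []))
        (cong (λ t → t * t) (trans (deg-swap x (yε ε) ws []) (trans (deg-+* y ε q (x ∷ ws) [])
          (cong₂ (λ s t → s + ε * t) (deg-swap y x ws []) (deg-swap q x ws [])))))
        (reverse-Cauchy–Schwarz ws [] ([] , []) len aws x (yε ε) (ny ε 0<ε))
    where
    yε : ℚ → LinForm m
    yε ε S = y S + ε * q S
  reverse-nef (u ∷ us) ws (nu ∷ nus) aws len x y ny =
    product-limit (D x x u) (D x x q) (D y y u) (D y y q) (D x y u) (D x y q) λ ε 0<ε →
      subst₂ _≤_ (cong₂ _*_ (expand ε x x) (expand ε y y)) (cong (λ t → t * t) (expand ε x y))
        (reverse-nef us (uε ε ∷ ws) nus (nu ε 0<ε ∷ aws) (trans (cong (λ k → suc (suc (k ℕ.+ 0))) (↭-length (shift (uε ε) us ws))) len) x y ny)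
    where
    uε : ℚ → LinForm m
    uε ε S = u S + ε * q S
    D : LinForm m → LinForm m → LinForm m → ℚ
    D a b v = deg (a ∷ b ∷ v ∷ us ++ ws) []
    front : ∀ a b v → D a b v ≡ deg (v ∷ a ∷ b ∷ us ++ ws) []
    front a b v = deg-↭ {a ∷ b ∷ v ∷ us ++ ws} {v ∷ a ∷ b ∷ us ++ ws} (↭-trans (prep a (swap b v ↭-refl)) (swap a v ↭-refl)) []
    expand : ∀ ε a b → deg (a ∷ b ∷ us ++ uε ε ∷ ws) [] ≡ D a b u + ε * D a b q
    expand ε a b = trans (deg-↭ {a ∷ b ∷ us ++ uε ε ∷ ws} {a ∷ b ∷ uε ε ∷ us ++ ws} (prep a (prep b (shift (uε ε) us ws))) [])
      (trans (front a b (uε ε)) (trans (deg-+* u ε q (a ∷ b ∷ us ++ ws) [])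
        (cong₂ (λ s t → s + ε * t) (sym (front a b u)) (sym (front a b q)))))

-- Products of hypersimplex classes

concatMap-replicate-length : ∀ {A B : Set} (c : A → ℕ) (g : A → B) xs →
  length (concatMap (λ t → replicate (c t) (g t)) xs) ≡ foldr ℕ._+_ 0 (map c xs)
concatMap-replicate-length c g [] = refl
concatMap-replicate-length c g (x ∷ xs) = trans (length-++ (replicate (c x) (g x)))
  (cong₂ ℕ._+_ (length-replicate (c x)) (concatMap-replicate-length c g xs))

concatMap-replicate-All : ∀ {A B : Set} {P : B → Set} (c : A → ℕ) (g : A → B) xs → (∀ x → P (g x)) →
  All P (concatMap (λ t → replicate (c t) (g t)) xs)
concatMap-replicate-All c g [] h = []
concatMap-replicate-All c g (x ∷ xs) h = All.++⁺ (All.replicate⁺ (c x) (h x)) (concatMap-replicate-All c g xs h)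

theorem2p5 : (n r : ℕ) (M : Matroid (suc n)) → Loopless M → rk M ⊤ ≡ suc r →
    (c : Fin n → ℕ) → sumFin n c ℕ.+ 2 ≡ r → (i j : Fin n) →
    (L : List (Subset (suc n)) → ℚ) → IsDeg M r L →
    evalProd M (γpow n c ++ (γ n (suc (toℕ i)) ∷ γ n (suc (toℕ i)) ∷ [])) L
    * evalProd M (γpow n c ++ (γ n (suc (toℕ j)) ∷ γ n (suc (toℕ j)) ∷ [])) L
    ≤ evalProd M (γpow n c ++ (γ n (suc (toℕ i)) ∷ γ n (suc (toℕ j)) ∷ [])) L
    * evalProd M (γpow n c ++ (γ n (suc (toℕ i)) ∷ γ n (suc (toℕ j)) ∷ [])) L
theorem2p5 n r M loopless rk-⊤ c len i j L isDeg =
  subst₂ _≤_ (sym (cong₂ _*_ (to-deg i i) (to-deg j j))) (sym (cong (λ t → t * t) (to-deg i j)))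
    (reverse-nef (γpow n c) [] (concatMap-replicate-All c g (allFin n) g-nef) [] len′ (g i) (g j) (g-nef j))
  where
  open Hypersimplex n
  open Classes M loopless
  open Degree M loopless r rk-⊤ L isDeg
  open NefLimit M loopless r rk-⊤ L isDeg parabola
  g : Fin n → LinForm (suc n)
  g t = γ n (suc (toℕ t))
  g-nef : ∀ t → Nef (g t)
  g-nef t ε 0<ε = concave⇒ample ⊥⊂⊤ (perturbed k k≤ ε) (perturbed-⊥ k k≤ ε) (perturbed-⊤ k k≤ ε) (perturbed-concave k k≤ ε 0<ε)
    where
    k : ℕ
    k = suc (toℕ t)
    k≤ : k ℕ.≤ suc n
    k≤ = ℕP.m≤n⇒m≤1+n (toℕ<n t)
  to-deg : ∀ a b → evalProd M (γpow n c ++ g a ∷ g b ∷ []) L ≡ deg (g a ∷ g b ∷ γpow n c ++ []) []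
  to-deg a b = trans (evalProd-deg (γpow n c ++ g a ∷ g b ∷ []) L [] (λ mon → cong L (sym (++-identityʳ mon))))
    (trans (deg-↭ (++-comm (γpow n c) (g a ∷ g b ∷ [])) []) (cong (λ vs → deg (g a ∷ g b ∷ vs) []) (sym (++-identityʳ (γpow n c)))))
  len′ : suc (suc (length (γpow n c ++ []) ℕ.+ 0)) ≡ r
  len′ = begin
    suc (suc (length (γpow n c ++ []) ℕ.+ 0))  ≡⟨ cong (λ k → suc (suc k)) (ℕP.+-identityʳ _) ⟩
    suc (suc (length (γpow n c ++ [])))        ≡⟨ cong (λ vs → suc (suc (length vs))) (++-identityʳ (γpow n c)) ⟩
    suc (suc (length (γpow n c)))              ≡⟨ cong (λ k → suc (suc k)) (concatMap-replicate-length c g (allFin n)) ⟩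
    2 ℕ.+ sumFin n c                           ≡⟨ ℕP.+-comm 2 (sumFin n c) ⟩
    sumFin n c ℕ.+ 2                           ≡⟨ len ⟩
    r ∎
    where open ≡-Reasoning
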